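{- Let $(G,\sigma)$ be a non-decomposable critically $3$-frustrated signed plane graph. Then $(G,\sigma)$ consists of six negative facial cycles, i.e. its facial cycles are exactly six in number and all of them are negative.
   Context: A signed graph $(G,\sigma)$ is a finite graph $G$ with a signature $\sigma:E(G)\to\{+,-\}$; a cycle is negative if it contains an odd number of negative edges. Switching at a vertex $v$ multiplies the signs of all edges incident with $v$ by $-$. The frustration index $\ell(G,\sigma)$ is the minimum number of negative edges over all signatures obtained from $\sigma$ by sequences of switchings. $(G,\sigma)$ is critically $k$-frustrated if $\ell(G,\sigma)=k$ and $\ell(G-e,\sigma)=k-1$ for every edge $e$. A critically $k$-frustrated $(G,\sigma)$ is decomposable if for some $t\ge2$ and positive integers $k_1,\dots,k_t$ with sum $k$, $E(G)$ can be partitioned into $E_1,\dots,E_t$ with each $(G[E_i],\sigma)$ critically $k_i$-frustrated; otherwise it is non-decomposable. Standing assumption: signed graphs have no loops and no two parallel edges of different signs. A signed plane graph is a signed graph with a fixed planar embedding of its underlying graph. -}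

module Defs where

open import Data.Nat using (ℕ; zero; suc; _+_; _*_; _≤_; _∸_)
open import Data.Fin using (Fin)
import Data.Fin as F
open import Data.Bool using (Bool; true; false; not; _xor_; _∧_; if_then_else_)
import Data.Bool as B
open import Data.Product using (Σ; ∃; _×_; _,_; proj₁; proj₂)
open import Data.Product.Properties using (≡-dec)
open import Data.Sum using (_⊎_)
open import Data.List using (List; []; _∷_; allFin; concatMap; map; upTo; foldr)
open import Data.Nat.ListAction using (sum)
open import Data.Bool.ListAction using (any)
open import Relation.Nullary.Decidable using (⌊_⌋)
open import Relation.Binary.PropositionalEquality using (_≡_; _≢_)
open import Relation.Binary.Construct.Closure.Equivalence using (EqClosure)

countB : {A : Set} → (A → Bool) → List A → ℕ
countB p []       = 0
countB p (x ∷ xs) = if p x then suc (countB p xs) else countB p xs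

iter : {A : Set} → (A → A) → ℕ → A → A
iter f zero    x = x
iter f (suc i) x = f (iter f i x)

eqFin : {n : ℕ} → Fin n → Fin n → Bool
eqFin a b = ⌊ a F.≟ b ⌋

Odd : ℕ → Set
Odd k = ∃ λ j → k ≡ suc (2 * j)

NumClasses : {A : Set} → (A → A → Set) → ℕ → Set
NumClasses {A} R k =
  Σ (A → Fin k) λ lab →
    (∀ j → ∃ λ x → lab x ≡ j) ×
    (∀ x y → (lab x ≡ lab y → R x y) × (R x y → lab x ≡ lab y))

Orbit : {A : Set} → (A → A) → A → A → Set
Orbit f x y = ∃ λ i → iter f i x ≡ y

SameEnds : {n : ℕ} → Fin n × Fin n → Fin n × Fin n → Set
SameEnds (a , b) (c , d) = (a ≡ c × b ≡ d) ⊎ (a ≡ d × b ≡ c)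

record SignedGraph : Set where
  field
    n m  : ℕ
    ends : Fin m → Fin n × Fin n
    neg  : Fin m → Bool
    loopless : ∀ e → proj₁ (ends e) ≢ proj₂ (ends e)
    parallelSameSign : ∀ e e' → SameEnds (ends e) (ends e') → neg e ≡ neg e'

module _ (G : SignedGraph) where
  open SignedGraph G

  Signature : Set
  Signature = Fin m → Bool

  switch : Fin n → Signature → Signature
  switch v s e = s e xor eqFin v (proj₁ (ends e)) xor eqFin v (proj₂ (ends e))

  switchSeq : List (Fin n) → Signature → Signature
  switchSeq vs s = foldr switch s vs

  -- edge sets (spanning subgraphs G[S])
  EdgeSet : Set
  EdgeSet = Fin m → Bool

  negCount : EdgeSet → Signature → ℕ
  negCount S s = countB (λ e → S e ∧ s e) (allFin m)

  Frustration : EdgeSet → ℕ → Set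
  Frustration S k =
    (∃ λ vs → negCount S (switchSeq vs neg) ≡ k) ×
    (∀ vs → k ≤ negCount S (switchSeq vs neg))

  deleteEdge : Fin m → EdgeSet → EdgeSet
  deleteEdge e S e' = S e' ∧ not (eqFin e e')

  CritFrustSub : EdgeSet → ℕ → Set
  CritFrustSub S k =
    Frustration S k × (∀ e → S e ≡ true → Frustration (deleteEdge e S) (k ∸ 1))

  allEdges : EdgeSet
  allEdges _ = true

  CriticallyFrustrated : ℕ → Set
  CriticallyFrustrated k = CritFrustSub allEdges k

  Decomposable : ℕ → Set
  Decomposable k =
    Σ ℕ λ t → 2 ≤ t ×
    Σ (Fin t → ℕ) λ ks → (∀ i → 1 ≤ ks i) × sum (map ks (allFin t)) ≡ k ×
    Σ (Fin m → Fin t) λ part →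
      ∀ i → CritFrustSub (λ e → eqFin (part e) i) (ks i)

  -- Plane embeddings as genus-0 combinatorial maps (rotation systems)

  Dart : Set
  Dart = Fin m × Bool

  rev : Dart → Dart
  rev (e , b) = (e , not b)

  tail : Dart → Fin n
  tail (e , false) = proj₁ (ends e)
  tail (e , true)  = proj₂ (ends e)

  darts : List Dart
  darts = concatMap (λ e → (e , false) ∷ (e , true) ∷ []) (allFin m)

  eqDart : Dart → Dart → Bool
  eqDart d d' = ⌊ ≡-dec F._≟_ B._≟_ d d' ⌋

  -- bounded (hence decidable) orbit membership; orbits have < 2m elements
  inOrbitB : (Dart → Dart) → Dart → Dart → Bool
  inOrbitB f d d' = any (λ i → eqDart (iter f i d) d') (upTo (2 * m))

  record PlaneEmbedding : Set where
    field
      ρ ρ⁻¹    : Dart → Dart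
      ρ-invˡ   : ∀ d → ρ⁻¹ (ρ d) ≡ d
      ρ-invʳ   : ∀ d → ρ (ρ⁻¹ d) ≡ d
      ρ-tail   : ∀ d → tail (ρ d) ≡ tail d
      ρ-cyclic : ∀ d d' → tail d ≡ tail d' → Orbit ρ d d'

    φ : Dart → Dart
    φ d = ρ (rev d)

    MapStep : Dart → Dart → Set
    MapStep d d' = (d' ≡ ρ d) ⊎ (d' ≡ rev d)

    field
      nV nF nC : ℕ
      vertexCount    : NumClasses (Orbit ρ) nV
      faceCount      : NumClasses (Orbit φ) nF
      componentCount : NumClasses (EqClosure MapStep) nC
      -- genus 0 on every component (Euler's formula)
      euler : nV + nF ≡ m + 2 * nC

  -- conclusion: exactly six faces, every facial boundary is a cycle
  -- and every facial cycle is negative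
  SixNegativeFacialCycles : PlaneEmbedding → Set
  SixNegativeFacialCycles P =
    NumClasses (Orbit φ) 6 ×
    (∀ d d' → Orbit φ d d' → d ≢ d' → tail d ≢ tail d' × proj₁ d ≢ proj₁ d') ×
    (∀ d → Odd (countB (λ d' → inOrbitB φ d d' ∧ neg (proj₁ d')) darts))
    where open PlaneEmbedding P

{-# OPTIONS --safe #-}
module Submission where

-- In the dual multigraph, whose vertices are the faces, the signatures switching-equivalent to σ are
-- exactly the T-joins, T being the set of negative faces; that every T-join arises from switchings is
-- where planarity enters (a spanning tree and a dual cotree, with Euler's formula).  So the minimum
-- T-join has 3 edges, and by criticality every edge lies in a minimum one; hence |T| is even and at
-- most 6.  If |T| ≤ 4, the absence of T-joins with fewer than 3 edges yields a face a ∈ T and odd cuts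
-- that avoid δ(a) and have no edge common to all of them; then δ(a) is critically 1-frustrated and its
-- complement critically 2-frustrated.  If |T| = 6, every minimum T-join is a perfect matching of T, so
-- all faces are negative and each carries exactly one edge of each minimum signature; a facial walk
-- repeating a vertex or an edge would contradict this.

open import Defs
open import Algebra.Bundles using (CommutativeRing)
open import Algebra.Structures using (IsCommutativeMonoid)
open import Data.Bool using (Bool; true; false; not; _xor_; _∧_; _∨_; if_then_else_)
import Data.Bool as B
open import Data.Bool.Properties using (xor-assoc; xor-comm; xor-same; xor-identityʳ; xor-∧-commutativeRing; ∧-distribˡ-xor; ∧-distribʳ-xor; ∧-comm; ∧-assoc; ∧-zeroʳ; ∧-identityʳ; T-≡)
open import Data.Fin as F using (Fin; zero; suc; punchIn; punchOut)
open import Data.Fin.Properties using (punchInᵢ≢i; punchOut-cong; punchOut-punchIn; injective⇒≤; any?; pigeonhole; combine-injective; toℕ<n)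
open import Data.List using (List; []; _∷_; allFin; map; length; filterᵇ; concatMap; upTo)
open import Data.List.Membership.Propositional using (_∈_; find; lose)
open import Data.List.Membership.Propositional.Properties using (∈-allFin; ∈-filter⁻; ∈-upTo⁺)
open import Data.List.Properties using (length-tabulate)
open import Data.List.Relation.Unary.All using (All; []; _∷_)
open import Data.List.Relation.Unary.AllPairs using ([]; _∷_)
open import Data.List.Relation.Unary.Any using (here; there)
open import Data.List.Relation.Unary.Any.Properties using (any⁺; any⁻)
open import Data.List.Relation.Unary.Unique.Propositional using (Unique)
open import Data.List.Relation.Unary.Unique.Propositional.Properties using (allFin⁺; filter⁺)
open import Data.Nat using (ℕ; zero; suc; _+_; _*_; _∸_; _≤_; _<_; z≤n; s≤s)
open import Data.Nat.Induction using (<-wellFounded)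
import Data.Nat.Properties as ℕ
open import Data.Nat.Tactic.RingSolver using (solve-∀)
open import Data.Product using (∃; _×_; _,_; proj₁; proj₂)
open import Data.Product.Properties using (≡-dec)
open import Data.Sum using (_⊎_; inj₁; inj₂; [_,_]′)
open import Function using (_∘_; id; Equivalence)
open import Induction.WellFounded using (Acc; acc)
open import Relation.Binary.Construct.Closure.Equivalence using (gfold)
open import Relation.Binary.PropositionalEquality using (_≡_; _≢_; refl; sym; trans; cong; cong₂; subst; isEquivalence; module ≡-Reasoning)
open import Relation.Nullary using (¬_; Dec; yes; no; contradiction)
open import Relation.Nullary.Decidable using (⌊_⌋; _×-dec_; _⊎-dec_; T?)

private
  variable
    A B : Set

-- Decidable equality and Boolean identities.

⌊⌋-true : ∀ {Q : Set} (q? : Dec Q) → Q → ⌊ q? ⌋ ≡ true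
⌊⌋-true (yes _) q = refl
⌊⌋-true (no ¬q) q = contradiction q ¬q

⌊⌋-false : ∀ {Q : Set} (q? : Dec Q) → ¬ Q → ⌊ q? ⌋ ≡ false
⌊⌋-false (yes q) ¬q = contradiction q ¬q
⌊⌋-false (no _)  ¬q = refl

⌊⌋-cong : ∀ {P Q : Set} (p? : Dec P) (q? : Dec Q) → (P → Q) → (Q → P) → ⌊ p? ⌋ ≡ ⌊ q? ⌋
⌊⌋-cong (yes p) (yes q) f g = refl
⌊⌋-cong (yes p) (no ¬q) f g = contradiction (f p) ¬q
⌊⌋-cong (no ¬p) (yes q) f g = contradiction (g q) ¬p
⌊⌋-cong (no ¬p) (no ¬q) f g = refl

eqFin-refl : ∀ {n} (a : Fin n) → eqFin a a ≡ true
eqFin-refl a = ⌊⌋-true (a F.≟ a) refl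

eqFin-sound : ∀ {n} {a b : Fin n} → eqFin a b ≡ true → a ≡ b
eqFin-sound {a = a} {b} eq with a F.≟ b
... | yes a≡b = a≡b

eqFin-≢ : ∀ {n} {a b : Fin n} → a ≢ b → eqFin a b ≡ false
eqFin-≢ {a = a} {b} = ⌊⌋-false (a F.≟ b)

eqFin-sym : ∀ {n} (a b : Fin n) → eqFin a b ≡ eqFin b a
eqFin-sym a b = ⌊⌋-cong (a F.≟ b) (b F.≟ a) sym sym

∧-true : ∀ {x y} → x ∧ y ≡ true → x ≡ true × y ≡ true
∧-true {true} {true} _ = refl , refl

xor-false : ∀ {x y} → x xor y ≡ false → x ≡ y
xor-false {false} {false} _ = refl
xor-false {true}  {true}  _ = refl

xor-telescope : ∀ a b c → (a xor b) xor (b xor c) ≡ a xor c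
xor-telescope a b c = trans (xor-assoc a b (b xor c))
  (cong (a xor_) (trans (sym (xor-assoc b b c)) (cong (_xor c) (xor-same b))))

-- Finite sums in a commutative monoid, used below both for xor and for addition.

module BigSum {C : Set} {_∙_ : C → C → C} {ε : C} (M : IsCommutativeMonoid _≡_ _∙_ ε) where
  open IsCommutativeMonoid M using (assoc; comm; identityˡ; identityʳ)

  interchange : ∀ a b c d → (a ∙ b) ∙ (c ∙ d) ≡ (a ∙ c) ∙ (b ∙ d)
  interchange a b c d = begin
    (a ∙ b) ∙ (c ∙ d) ≡⟨ assoc a b (c ∙ d) ⟩
    a ∙ (b ∙ (c ∙ d)) ≡⟨ cong (a ∙_) (assoc b c d) ⟨
    a ∙ ((b ∙ c) ∙ d) ≡⟨ cong (λ z → a ∙ (z ∙ d)) (comm b c) ⟩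
    a ∙ ((c ∙ b) ∙ d) ≡⟨ cong (a ∙_) (assoc c b d) ⟩
    a ∙ (c ∙ (b ∙ d)) ≡⟨ assoc a c (b ∙ d) ⟨
    (a ∙ c) ∙ (b ∙ d) ∎
    where open ≡-Reasoning

  big : List A → (A → C) → C
  big []       f = ε
  big (x ∷ xs) f = f x ∙ big xs f

  big-cong : ∀ (xs : List A) {f g} → (∀ x → f x ≡ g x) → big xs f ≡ big xs g
  big-cong []       eq = refl
  big-cong (x ∷ xs) eq = cong₂ _∙_ (eq x) (big-cong xs eq)

  big-ε : ∀ (xs : List A) → big xs (λ _ → ε) ≡ ε
  big-ε []       = refl
  big-ε (x ∷ xs) = trans (identityˡ _) (big-ε xs)

  big-∙ : ∀ (xs : List A) (f g : A → C) → big xs (λ x → f x ∙ g x) ≡ big xs f ∙ big xs g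
  big-∙ []       f g = sym (identityˡ ε)
  big-∙ (x ∷ xs) f g = trans (cong ((f x ∙ g x) ∙_) (big-∙ xs f g)) (interchange _ _ _ _)

  big-swap : ∀ (xs : List A) (ys : List B) (f : A → B → C) →
             big xs (λ x → big ys (f x)) ≡ big ys (λ y → big xs (λ x → f x y))
  big-swap []       ys f = sym (big-ε ys)
  big-swap (x ∷ xs) ys f =
    trans (cong (big ys (f x) ∙_) (big-swap xs ys f)) (sym (big-∙ ys (f x) _))

  big-absent : ∀ {a : A} (xs : List A) {f} → All (a ≢_) xs → (∀ x → a ≢ x → f x ≡ ε) → big xs f ≡ ε
  big-absent []       []            f≡ε = refl
  big-absent (x ∷ xs) (a≢x ∷ a∉xs) f≡ε =
    trans (cong₂ _∙_ (f≡ε x a≢x) (big-absent xs a∉xs f≡ε)) (identityˡ ε)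

  big-single : ∀ {a : A} (xs : List A) {f} → Unique xs → a ∈ xs → (∀ x → a ≢ x → f x ≡ ε) → big xs f ≡ f a
  big-single (x ∷ xs) {f} (x∉xs ∷ _) (here refl) f≡ε =
    trans (cong (f x ∙_) (big-absent xs x∉xs f≡ε)) (identityʳ (f x))
  big-single {a = a} (x ∷ xs) {f} (x∉xs ∷ u) (there a∈xs) f≡ε =
    trans (cong₂ _∙_ (f≡ε x (λ { refl → absurd x∉xs a∈xs })) (big-single xs u a∈xs f≡ε)) (identityˡ (f a))
    where
    absurd : ∀ {zs} → All (a ≢_) zs → ¬ a ∈ zs
    absurd (a≢z ∷ _) (here a≡z)  = a≢z a≡z
    absurd (_ ∷ ps)  (there a∈zs) = absurd ps a∈zs

  big-allFin-single : ∀ {n} {a : Fin n} {f} → (∀ x → a ≢ x → f x ≡ ε) → big (allFin n) f ≡ f a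
  big-allFin-single {n} {a} = big-single (allFin n) (allFin⁺ n) (∈-allFin a)

xor-isCommutativeMonoid : IsCommutativeMonoid _≡_ _xor_ false
xor-isCommutativeMonoid =
  CommutativeRing.+-isCommutativeMonoid xor-∧-commutativeRing

open BigSum xor-isCommutativeMonoid
  renaming (big to ⨁; big-cong to ⨁-cong; big-ε to ⨁-false; big-∙ to ⨁-xor; big-swap to ⨁-swap; big-allFin-single to ⨁-single)
  using (interchange)

open BigSum ℕ.+-0-isCommutativeMonoid
  renaming (big to ∑; big-cong to ∑-cong; big-∙ to ∑-+; big-ε to ∑-0; big-allFin-single to ∑-single)
  using ()

-- Sums modulo 2.

⨁-∧ : ∀ (xs : List A) b (f : A → Bool) → ⨁ xs (λ x → b ∧ f x) ≡ b ∧ ⨁ xs f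
⨁-∧ xs true  f = refl
⨁-∧ xs false f = ⨁-false xs

⨁-indicator : ∀ {n} (a : Fin n) (f : Fin n → Bool) → ⨁ (allFin n) (λ x → f x ∧ eqFin a x) ≡ f a
⨁-indicator a f = trans (⨁-single (λ x a≢x → trans (cong (f x ∧_) (eqFin-≢ a≢x)) (∧-zeroʳ (f x))))
  (trans (cong (f a ∧_) (eqFin-refl a)) (∧-identityʳ (f a)))

⨁-witness : ∀ (xs : List A) {f} → ⨁ xs f ≡ true → ∃ λ x → x ∈ xs × f x ≡ true
⨁-witness (x ∷ xs) {f} eq with f x in fx
... | true  = x , here refl , fx
... | false with y , y∈xs , fy ← ⨁-witness xs eq = y , there y∈xs , fy

⨁-map : ∀ (g : A → B) xs (f : B → Bool) → ⨁ (map g xs) f ≡ ⨁ xs (f ∘ g)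
⨁-map g []       f = refl
⨁-map g (x ∷ xs) f = cong (f (g x) xor_) (⨁-map g xs f)

⨁-filter : ∀ (p : A → Bool) xs f → ⨁ (filterᵇ p xs) f ≡ ⨁ xs (λ x → p x ∧ f x)
⨁-filter p []       f = refl
⨁-filter p (x ∷ xs) f with p x
... | true  = cong (f x xor_) (⨁-filter p xs f)
... | false = ⨁-filter p xs f

-- Counting, parity and double counting.

𝟙 : Bool → ℕ
𝟙 b = if b then 1 else 0

odd? : ℕ → Bool
odd? zero    = false
odd? (suc n) = not (odd? n)

odd?⇒Odd : ∀ k → odd? k ≡ true → Odd k
odd?⇒Odd (suc zero) _ = 0 , refl
odd?⇒Odd (suc (suc k)) eq with odd? k in eq′
... | true with j , refl ← odd?⇒Odd k eq′ = suc j , cong suc (cong suc (sym (ℕ.+-suc j (j + 0))))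

countB-∑ : ∀ (p : A → Bool) xs → countB p xs ≡ ∑ xs (𝟙 ∘ p)
countB-∑ p []       = refl
countB-∑ p (x ∷ xs) with p x
... | true  = cong suc (countB-∑ p xs)
... | false = countB-∑ p xs

countB-cong : ∀ {p q : A → Bool} xs → (∀ x → p x ≡ q x) → countB p xs ≡ countB q xs
countB-cong {p = p} {q} xs eq =
  trans (countB-∑ p xs) (trans (∑-cong xs (cong 𝟙 ∘ eq)) (sym (countB-∑ q xs)))

odd?-countB : ∀ (p : A → Bool) xs → odd? (countB p xs) ≡ ⨁ xs p
odd?-countB p []       = refl
odd?-countB p (x ∷ xs) with p x
... | true  = cong not (odd?-countB p xs)
... | false = odd?-countB p xs

countB-filter : ∀ (p : A → Bool) xs → length (filterᵇ p xs) ≡ countB p xs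
countB-filter p []       = refl
countB-filter p (x ∷ xs) with p x
... | true  = cong suc (countB-filter p xs)
... | false = countB-filter p xs

countB-split : ∀ (p q : A → Bool) xs →
               countB (λ x → q x ∧ p x) xs + countB (λ x → not (q x) ∧ p x) xs ≡ countB p xs
countB-split p q xs = begin
  countB (λ x → q x ∧ p x) xs + countB (λ x → not (q x) ∧ p x) xs
    ≡⟨ cong₂ _+_ (countB-∑ _ xs) (countB-∑ _ xs) ⟩
  ∑ xs (λ x → 𝟙 (q x ∧ p x)) + ∑ xs (λ x → 𝟙 (not (q x) ∧ p x))
    ≡⟨ ∑-+ xs _ _ ⟨
  ∑ xs (λ x → 𝟙 (q x ∧ p x) + 𝟙 (not (q x) ∧ p x))
    ≡⟨ ∑-cong xs (λ x → split (q x) (p x)) ⟩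
  ∑ xs (𝟙 ∘ p)
    ≡⟨ countB-∑ p xs ⟨
  countB p xs ∎
  where
  open ≡-Reasoning
  split : ∀ a b → 𝟙 (a ∧ b) + 𝟙 (not a ∧ b) ≡ 𝟙 b
  split true  b = ℕ.+-identityʳ (𝟙 b)
  split false b = refl

countB-≥1 : ∀ {p : A → Bool} {xs x} → x ∈ xs → p x ≡ true → 1 ≤ countB p xs
countB-≥1 (here refl) px rewrite px = s≤s z≤n
countB-≥1 {p = p} {y ∷ _} (there x∈xs) px with p y
... | true  = s≤s z≤n
... | false = countB-≥1 x∈xs px

countB-≥2 : ∀ {p : A → Bool} {xs x y} → x ∈ xs → y ∈ xs → x ≢ y →
            p x ≡ true → p y ≡ true → 2 ≤ countB p xs
countB-≥2 (here refl) (here refl) x≢y px py = contradiction refl x≢y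
countB-≥2 (here refl) (there y∈xs) x≢y px py rewrite px = s≤s (countB-≥1 y∈xs py)
countB-≥2 (there x∈xs) (here refl) x≢y px py rewrite py = s≤s (countB-≥1 x∈xs px)
countB-≥2 {p = p} {z ∷ _} (there x∈xs) (there y∈xs) x≢y px py with p z
... | true  = s≤s (countB-≥1 x∈xs px)
... | false = countB-≥2 x∈xs y∈xs x≢y px py

countB-eqFin : ∀ {n} (a : Fin n) (p : Fin n → Bool) → countB (λ x → eqFin a x ∧ p x) (allFin n) ≡ 𝟙 (p a)
countB-eqFin {n} a p = trans (countB-∑ (λ x → eqFin a x ∧ p x) (allFin n))
  (trans (∑-single (λ x a≢x → cong (λ b → 𝟙 (b ∧ p x)) (eqFin-≢ a≢x)))
         (cong (λ b → 𝟙 (b ∧ p a)) (eqFin-refl a)))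

countB-delete : ∀ {n} (a : Fin n) (p : Fin n → Bool) →
                𝟙 (p a) + countB (λ x → not (eqFin a x) ∧ p x) (allFin n) ≡ countB p (allFin n)
countB-delete {n} a p = trans (cong (_+ countB (λ x → not (eqFin a x) ∧ p x) (allFin n)) (sym (countB-eqFin a p)))
  (countB-split p (eqFin a) (allFin n))

countB-xor-≤ : ∀ (p q : A → Bool) xs → countB (λ x → p x xor q x) xs ≤ countB p xs + countB q xs
countB-xor-≤ p q []       = z≤n
countB-xor-≤ p q (x ∷ xs) with p x | q x
... | true  | true  = ℕ.m≤n⇒m≤1+n (ℕ.≤-trans (countB-xor-≤ p q xs) (ℕ.+-monoʳ-≤ (countB p xs) (ℕ.n≤1+n _)))
... | true  | false = s≤s (countB-xor-≤ p q xs)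
... | false | true  = ℕ.≤-trans (s≤s (countB-xor-≤ p q xs)) (ℕ.≤-reflexive (sym (ℕ.+-suc _ _)))
... | false | false = countB-xor-≤ p q xs

∑-mono : ∀ (xs : List A) {f g : A → ℕ} → (∀ x → f x ≤ g x) → ∑ xs f ≤ ∑ xs g
∑-mono []       f≤g = z≤n
∑-mono (x ∷ xs) f≤g = ℕ.+-mono-≤ (f≤g x) (∑-mono xs f≤g)

-- No term has negative slack and the total slack is zero, so every single slack is zero.
∑-tight : ∀ {xs : List A} {f g : A → ℕ} → (∀ x → f x ≤ g x) → ∑ xs g ≤ ∑ xs f →
          ∀ {x} → x ∈ xs → g x ≤ f x
∑-tight {xs = x ∷ xs} {f} {g} f≤g le (here refl) =
  ℕ.+-cancelʳ-≤ (∑ xs g) _ _ (ℕ.≤-trans le (ℕ.+-monoʳ-≤ (f x) (∑-mono xs f≤g)))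
∑-tight {xs = x ∷ xs} {f} {g} f≤g le (there y∈xs) =
  ∑-tight f≤g (ℕ.+-cancelˡ-≤ (g x) _ _ (ℕ.≤-trans le (ℕ.+-monoˡ-≤ (∑ xs f) (f≤g x)))) y∈xs

-- Each element is counted only at the `j` equal to its image. With `g = face` this is the handshake
-- count of the dual.
∑-fibres : ∀ {n} (g : A → Fin n) (p : A → Bool) xs →
           ∑ (allFin n) (λ j → countB (λ x → eqFin j (g x) ∧ p x) xs) ≡ countB p xs
∑-fibres {n = n} g p [] = ∑-0 (allFin n)
∑-fibres {n = n} g p (x ∷ xs) = begin
  ∑ (allFin n) (λ j → countB (λ y → eqFin j (g y) ∧ p y) (x ∷ xs))
    ≡⟨ ∑-cong (allFin n) (λ j → step (λ y → eqFin j (g y) ∧ p y)) ⟩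
  ∑ (allFin n) (λ j → 𝟙 (eqFin j (g x) ∧ p x) + countB (λ y → eqFin j (g y) ∧ p y) xs)
    ≡⟨ ∑-+ (allFin n) _ _ ⟩
  ∑ (allFin n) (λ j → 𝟙 (eqFin j (g x) ∧ p x)) + ∑ (allFin n) (λ j → countB (λ y → eqFin j (g y) ∧ p y) xs)
    ≡⟨ cong₂ _+_ (trans (∑-single {a = g x} (λ j gx≢j → cong (λ b → 𝟙 (b ∧ p x)) (eqFin-≢ (gx≢j ∘ sym))))
                        (cong (λ b → 𝟙 (b ∧ p x)) (eqFin-refl (g x))))
                 (∑-fibres g p xs) ⟩
  𝟙 (p x) + countB p xs
    ≡⟨ step p ⟨
  countB p (x ∷ xs) ∎
  where
  open ≡-Reasoning
  step : ∀ q → countB q (x ∷ xs) ≡ 𝟙 (q x) + countB q xs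
  step q with q x
  ... | true  = refl
  ... | false = refl

-- Spanning forests of a multigraph.

merge : ∀ {k} (p q : Fin (suc k)) → p ≢ q →
        ∃ λ (μ : Fin (suc k) → Fin k) → μ p ≡ μ q × ∀ j → ∃ λ i → μ i ≡ j
merge {k} p q p≢q = μ , μp≡μq , λ j → punchIn q j , μ-punchIn j
  where
  -- `q` is sent to the place of `p`, and the gap that it leaves is closed up.
  μ : Fin (suc k) → Fin k
  μ i with q F.≟ i
  ... | yes _  = punchOut (p≢q ∘ sym)
  ... | no q≢i = punchOut q≢i

  μp≡μq : μ p ≡ μ q
  μp≡μq with q F.≟ p | q F.≟ q
  ... | yes q≡p | _      = contradiction (sym q≡p) p≢q
  ... | no _    | yes _  = punchOut-cong q refl
  ... | no _    | no q≢q = contradiction refl q≢q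

  μ-punchIn : ∀ j → μ (punchIn q j) ≡ j
  μ-punchIn j with q F.≟ punchIn q j
  ... | yes q≡ = contradiction (sym q≡) (punchInᵢ≢i q j)
  ... | no _   = trans (punchOut-cong q refl) (punchOut-punchIn q)

-- A spanning forest of the multigraph with edge list es: the labels are its components,
-- and `potential` says that the tree edges are independent in the cut space.
record Forest {E : Set} {N : ℕ} (l r : E → Fin N) (es : List E) : Set where
  field
    c            : ℕ
    tree cotree  : List E
    tree⊆        : ∀ {e} → e ∈ tree → e ∈ es
    split        : ∀ {e} → e ∈ es → e ∈ tree ⊎ e ∈ cotree
    split-length : length tree + length cotree ≡ length es
    rank         : length tree + c ≡ N
    label        : Fin N → Fin c
    label-surj   : ∀ j → ∃ λ v → label v ≡ j
    label-const  : ∀ {e} → e ∈ es → label (l e) ≡ label (r e)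
    potential    : ∀ (s : E → Bool) → ∃ λ (x : Fin N → Bool) →
                   ∀ {e} → e ∈ tree → x (l e) xor x (r e) ≡ s e

-- Kruskal's procedure: an edge inside one component goes to the cotree; an edge between two
-- components goes to the tree, and the two labels are merged.
spanningForest : ∀ {E : Set} {N} (l r : E → Fin N) es → Forest l r es
spanningForest {N = N} l r [] = record
  { c = N ; tree = [] ; cotree = [] ; tree⊆ = λ () ; split = λ () ; split-length = refl
  ; rank = refl ; label = id ; label-surj = λ j → j , refl ; label-const = λ ()
  ; potential = λ s → (λ _ → false) , λ () }
spanningForest {E} {N} l r (e₀ ∷ es) = extend (spanningForest l r es)
  where
  extend : Forest l r es → Forest l r (e₀ ∷ es)
  -- `l e₀` is a vertex, so there is at least one component to label it.
  extend record { c = zero ; label = label } = contradiction (label (l e₀)) λ ()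
  extend record { c = suc c ; tree = tree ; cotree = cotree ; tree⊆ = tree⊆ ; split = split
                ; split-length = split-length ; rank = rank ; label = label
                ; label-surj = label-surj ; label-const = label-const ; potential = potential }
    with label (l e₀) F.≟ label (r e₀)
  ... | yes eq = record
    { c = suc c ; tree = tree ; cotree = e₀ ∷ cotree ; tree⊆ = there ∘ tree⊆
    ; split = λ { (here refl) → inj₂ (here refl)
                ; (there e∈es) → [ inj₁ , inj₂ ∘ there ]′ (split e∈es) }
    ; split-length = trans (ℕ.+-suc _ _) (cong suc split-length)
    ; rank = rank ; label = label ; label-surj = label-surj
    ; label-const = λ { (here refl) → eq ; (there e∈es) → label-const e∈es }
    ; potential = potential }
  ... | no neq with merge (label (l e₀)) (label (r e₀)) neq
  ... | μ , μ-eq , μ-surj = record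
    { c = c ; tree = e₀ ∷ tree ; cotree = cotree
    ; tree⊆ = λ { (here refl) → here refl ; (there e∈t) → there (tree⊆ e∈t) }
    ; split = λ { (here refl) → inj₁ (here refl)
                ; (there e∈es) → [ inj₁ ∘ there , inj₂ ]′ (split e∈es) }
    ; split-length = cong suc split-length
    ; rank = trans (sym (ℕ.+-suc _ _)) rank
    ; label = μ ∘ label
    ; label-surj = surj
    ; label-const = λ { (here refl) → μ-eq ; (there e∈es) → cong μ (label-const e∈es) }
    ; potential = pot }
    where
    surj : ∀ j → ∃ λ v → μ (label v) ≡ j
    surj j with i , μi≡j ← μ-surj j with v , refl ← label-surj i = v , μi≡j

    -- Flipping the potential on one side of e₀ corrects e₀ and changes no other tree edge.
    pot : ∀ (s : E → Bool) → ∃ λ (x : Fin N → Bool) →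
          ∀ {e} → e ∈ e₀ ∷ tree → x (l e) xor x (r e) ≡ s e
    pot s with x , x-ok ← potential s = x′ , ok
      where
      defect : Bool
      defect = s e₀ xor (x (l e₀) xor x (r e₀))
      side x′ : Fin N → Bool
      side v = defect ∧ eqFin (label (l e₀)) (label v)
      x′ v = x v xor side v

      repair : ∀ a b → a xor (b xor a) ≡ b
      repair a b = trans (xor-comm a (b xor a)) (trans (xor-assoc b a a)
                     (trans (cong (b xor_) (xor-same a)) (xor-identityʳ b)))

      side-e₀ : side (l e₀) xor side (r e₀) ≡ defect
      side-e₀ rewrite eqFin-refl (label (l e₀)) | eqFin-≢ neq with defect
      ... | true  = refl
      ... | false = refl

      ok : ∀ {e} → e ∈ e₀ ∷ tree → x′ (l e) xor x′ (r e) ≡ s e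
      ok (here refl) = trans (interchange (x (l e₀)) _ _ _)
        (trans (cong ((x (l e₀) xor x (r e₀)) xor_) side-e₀) (repair (x (l e₀) xor x (r e₀)) (s e₀)))
      ok {e} (there e∈t) = trans (interchange (x (l e)) _ _ _)
        (trans (cong₂ _xor_ (x-ok e∈t)
                 (trans (cong (_xor side (r e)) (cong (λ j → defect ∧ eqFin (label (l e₀)) j) (label-const (tree⊆ e∈t))))
                        (xor-same (side (r e)))))
               (xor-identityʳ (s e)))

-- Darts, cuts modulo 2 and the effect of switching.

module Darts (G : SignedGraph) where
  open SignedGraph G

  edges : List (Fin m)
  edges = allFin m

  private
    both : Fin m → List (Dart G)
    both e = (e , false) ∷ (e , true) ∷ []

  ⨁-darts : ∀ f → ⨁ (darts G) f ≡ ⨁ edges (λ e → f (e , false) xor f (e , true))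
  ⨁-darts f = go edges
    where
    go : ∀ es → ⨁ (concatMap both es) f ≡ ⨁ es (λ e → f (e , false) xor f (e , true))
    go []       = refl
    go (e ∷ es) = trans (cong (λ z → f (e , false) xor (f (e , true) xor z)) (go es))
                        (sym (xor-assoc (f (e , false)) _ _))

  ∈-darts : ∀ d → d ∈ darts G
  ∈-darts (e , b) = go b (∈-allFin e)
    where
    go : ∀ b {es} → e ∈ es → (e , b) ∈ concatMap both es
    go false (here refl)  = here refl
    go true  (here refl)  = there (here refl)
    go b     (there e∈es) = there (there (go b e∈es))

  countB-darts : ∀ s → countB (s ∘ proj₁) (darts G) ≡ countB s edges + countB s edges
  countB-darts s = go edges
    where
    go : ∀ es → countB (s ∘ proj₁) (concatMap both es) ≡ countB s es + countB s es
    go []       = refl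
    go (e ∷ es) with s e
    ... | true  = cong suc (trans (cong suc (go es)) (sym (ℕ.+-suc _ _)))
    ... | false = go es

  dart? : (d d′ : Dart G) → Dec (d ≡ d′)
  dart? = ≡-dec F._≟_ B._≟_

  ⨁-dart : ∀ a (g : Dart G → Bool) → ⨁ (darts G) (λ d → eqDart G a d ∧ g d) ≡ g a
  ⨁-dart a@(e , b) g = trans (⨁-darts (λ d → eqDart G a d ∧ g d)) (trans (⨁-single off) (at b))
    where
    off : ∀ x → e ≢ x → (eqDart G a (x , false) ∧ g (x , false)) xor (eqDart G a (x , true) ∧ g (x , true)) ≡ false
    off x e≢x = cong₂ (λ p q → (p ∧ g (x , false)) xor (q ∧ g (x , true)))
      (⌊⌋-false (dart? a (x , false)) (e≢x ∘ cong proj₁)) (⌊⌋-false (dart? a (x , true)) (e≢x ∘ cong proj₁))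
    at : ∀ b → (eqDart G (e , b) (e , false) ∧ g (e , false)) xor (eqDart G (e , b) (e , true) ∧ g (e , true)) ≡ g (e , b)
    at false = trans (cong₂ (λ p q → (p ∧ g (e , false)) xor (q ∧ g (e , true)))
      (⌊⌋-true (dart? (e , false) (e , false)) refl) (⌊⌋-false (dart? (e , false) (e , true)) (λ ()))) (xor-identityʳ _)
    at true = cong₂ (λ p q → (p ∧ g (e , false)) xor (q ∧ g (e , true)))
      (⌊⌋-false (dart? (e , true) (e , false)) (λ ())) (⌊⌋-true (dart? (e , true) (e , true)) refl)

  -- Expand `g (f d)` as a sum against the indicator of `f d`, exchange the two sums, and read the
  -- indicator through `f⁻¹`.
  ⨁-permute : ∀ (f f⁻¹ : Dart G → Dart G) → (∀ d → f⁻¹ (f d) ≡ d) → (∀ d → f (f⁻¹ d) ≡ d) →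
              ∀ g → ⨁ (darts G) (g ∘ f) ≡ ⨁ (darts G) g
  ⨁-permute f f⁻¹ invˡ invʳ g = begin
    ⨁ ds (g ∘ f)                                            ≡⟨ ⨁-cong ds (λ d → ⨁-dart (f d) g) ⟨
    ⨁ ds (λ d → ⨁ ds (λ d′ → eqDart G (f d) d′ ∧ g d′))      ≡⟨ ⨁-swap ds ds _ ⟩
    ⨁ ds (λ d′ → ⨁ ds (λ d → eqDart G (f d) d′ ∧ g d′))
      ≡⟨ ⨁-cong ds (λ d′ → ⨁-cong ds (λ d → cong (_∧ g d′) (⌊⌋-cong (dart? (f d) d′) (dart? (f⁻¹ d′) d)
           (λ { refl → invˡ d }) (λ { refl → invʳ d′ })))) ⟩
    ⨁ ds (λ d′ → ⨁ ds (λ d → eqDart G (f⁻¹ d′) d ∧ g d′))    ≡⟨ ⨁-cong ds (λ d′ → ⨁-dart (f⁻¹ d′) (λ _ → g d′)) ⟩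
    ⨁ ds g ∎
    where
    open ≡-Reasoning
    ds = darts G

  -- The coboundary modulo 2: a vertex cut when `X` depends only on the tail of a dart, a cut of the
  -- dual when it depends only on the face.
  ∂ : (Dart G → Bool) → Fin m → Bool
  ∂ X e = X (e , false) xor X (e , true)

  ∂-dart : ∀ X d → ∂ X (proj₁ d) ≡ X d xor X (rev G d)
  ∂-dart X (e , false) = refl
  ∂-dart X (e , true)  = xor-comm (X (e , false)) (X (e , true))

  ⟪_,_⟫ : (Fin m → Bool) → (Dart G → Bool) → Bool
  ⟪ s , Y ⟫ = ⨁ edges (λ e → s e ∧ ∂ Y e)

  ⟪⟫-cong : ∀ {s t} Y → (∀ e → s e ≡ t e) → ⟪ s , Y ⟫ ≡ ⟪ t , Y ⟫
  ⟪⟫-cong Y eq = ⨁-cong edges (λ e → cong (_∧ ∂ Y e) (eq e))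

  ⟪⟫-xor : ∀ s t Y → ⟪ (λ e → s e xor t e) , Y ⟫ ≡ ⟪ s , Y ⟫ xor ⟪ t , Y ⟫
  ⟪⟫-xor s t Y = trans (⨁-cong edges (λ e → ∧-distribʳ-xor (∂ Y e) (s e) (t e))) (⨁-xor edges _ _)

  ⟪⟫-edge : ∀ e Y → ⟪ eqFin e , Y ⟫ ≡ ∂ Y e
  ⟪⟫-edge e Y = trans (⨁-cong edges (λ x → ∧-comm (eqFin e x) (∂ Y x))) (⨁-indicator e (∂ Y))

  -- Summing over darts counts an edge with both sides in `Y` twice, hence not at all modulo 2, just
  -- as `∂ Y` does.
  ⟪⟫-darts : ∀ s Y → ⨁ (darts G) (λ d → Y d ∧ s (proj₁ d)) ≡ ⟪ s , Y ⟫
  ⟪⟫-darts s Y = trans (⨁-darts _) (⨁-cong edges (λ e →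
    trans (sym (∧-distribʳ-xor (s e) (Y (e , false)) (Y (e , true)))) (∧-comm (∂ Y e) (s e))))

  -- Each switch adds the cut of its vertex, so a sequence adds the cut of the set of vertices that
  -- occur in it an odd number of times.
  switchSeq-∂ : ∀ vs s e → switchSeq G vs s e ≡ s e xor ∂ (λ d → ⨁ vs (λ v → eqFin v (tail G d))) e
  switchSeq-∂ []       s e = sym (xor-identityʳ (s e))
  switchSeq-∂ (v ∷ vs) s e = begin
    switchSeq G vs s e xor ∂v          ≡⟨ cong (_xor ∂v) (switchSeq-∂ vs s e) ⟩
    (s e xor ∂vs) xor ∂v               ≡⟨ xor-assoc (s e) ∂vs ∂v ⟩
    s e xor (∂vs xor ∂v)               ≡⟨ cong (s e xor_) (xor-comm ∂vs ∂v) ⟩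
    s e xor (∂v xor ∂vs)               ≡⟨ cong (s e xor_) (interchange (eqFin v (proj₁ (ends e))) _ _ _) ⟩
    s e xor ∂ (λ d → ⨁ (v ∷ vs) (λ w → eqFin w (tail G d))) e ∎
    where
    open ≡-Reasoning
    ∂v ∂vs : Bool
    ∂v = eqFin v (proj₁ (ends e)) xor eqFin v (proj₂ (ends e))
    ∂vs = ∂ (λ d → ⨁ vs (λ w → eqFin w (tail G d))) e

-- Vertices, faces and orthogonality of their cuts in a plane map.

module Plane (G : SignedGraph) (P : PlaneEmbedding G) where
  open SignedGraph G
  open PlaneEmbedding P
  open Darts G

  face : Dart G → Fin nF
  face = proj₁ faceCount

  -- An isolated vertex carries no dart and hence has no label here.
  vert : Dart G → Fin nV
  vert = proj₁ vertexCount

  face-φ : ∀ d → face (φ d) ≡ face d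
  face-φ d = sym (proj₂ (proj₂ (proj₂ faceCount) d (φ d)) (1 , refl))

  vert-ρ : ∀ d → vert (ρ d) ≡ vert d
  vert-ρ d = sym (proj₂ (proj₂ (proj₂ vertexCount) d (ρ d)) (1 , refl))

  tail⇒vert : ∀ {d d′} → tail G d ≡ tail G d′ → vert d ≡ vert d′
  tail⇒vert {d} {d′} eq = proj₂ (proj₂ (proj₂ vertexCount) d d′) (ρ-cyclic d d′ eq)

  vert⇒tail : ∀ {d d′} → vert d ≡ vert d′ → tail G d ≡ tail G d′
  vert⇒tail {d} {d′} eq with i , refl ← proj₁ (proj₂ (proj₂ vertexCount) d d′) eq = sym (go i)
    where
    go : ∀ i → tail G (iter ρ i d) ≡ tail G d
    go zero    = refl
    go (suc i) = trans (ρ-tail _) (go i)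

  rev-rev : ∀ d → rev G (rev G d) ≡ d
  rev-rev (e , false) = refl
  rev-rev (e , true)  = refl

  φ⁻¹ : Dart G → Dart G
  φ⁻¹ d = rev G (ρ⁻¹ d)

  -- The coboundary of a vertex potential is orthogonal to the boundary of a set of faces.
  orthogonal : ∀ {X Y} → (∀ d → X (ρ d) ≡ X d) → (∀ d → Y (φ d) ≡ Y d) → ⟪ ∂ X , Y ⟫ ≡ false
  orthogonal {X} {Y} X-ρ Y-φ = begin
    ⟪ ∂ X , Y ⟫                                         ≡⟨ ⟪⟫-darts (∂ X) Y ⟨
    ⨁ ds (λ d → Y d ∧ ∂ X (proj₁ d))                    ≡⟨ ⨁-cong ds (λ d → cong (Y d ∧_) (∂-dart X d)) ⟩
    ⨁ ds (λ d → Y d ∧ (X d xor X (rev G d)))            ≡⟨ ⨁-cong ds (λ d → ∧-distribˡ-xor (Y d) _ _) ⟩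
    ⨁ ds (λ d → (Y d ∧ X d) xor (Y d ∧ X (rev G d)))    ≡⟨ ⨁-xor ds _ _ ⟩
    ⨁ ds (λ d → Y d ∧ X d) xor ⨁ ds (λ d → Y d ∧ X (rev G d))
      ≡⟨ cong (⨁ ds (λ d → Y d ∧ X d) xor_) (⨁-cong ds (λ d → cong₂ _∧_ (sym (Y-φ d)) (sym (X-ρ (rev G d))))) ⟩
    ⨁ ds (λ d → Y d ∧ X d) xor ⨁ ds (λ d → Y (φ d) ∧ X (φ d))
      ≡⟨ cong (⨁ ds (λ d → Y d ∧ X d) xor_) (⨁-permute φ φ⁻¹
           (λ d → trans (cong (rev G) (ρ-invˡ _)) (rev-rev d))
           (λ d → trans (cong ρ (rev-rev _)) (ρ-invʳ d)) (λ d → Y d ∧ X d)) ⟩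
    ⨁ ds (λ d → Y d ∧ X d) xor ⨁ ds (λ d → Y d ∧ X d)  ≡⟨ xor-same (⨁ ds (λ d → Y d ∧ X d)) ⟩
    false ∎
    where
    open ≡-Reasoning
    ds = darts G

  orthogonal-labels : ∀ (x : Fin nV → Bool) (y : Fin nF → Bool) → ⟪ ∂ (x ∘ vert) , y ∘ face ⟫ ≡ false
  orthogonal-labels x y = orthogonal (cong x ∘ vert-ρ) (cong y ∘ face-φ)

  -- `g` is constant on connected components, so representatives of distinct labels lie in distinct
  -- components.
  invariantLabels-≤ : ∀ {k} (g : Dart G → Fin k) → (∀ j → ∃ λ d → g d ≡ j) →
                      (∀ d → g (ρ d) ≡ g d) → (∀ d → g (rev G d) ≡ g d) → k ≤ nC
  invariantLabels-≤ {k} g g-surj g-ρ g-rev = injective⇒≤ {f = comp ∘ rep} inj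
    where
    comp : Dart G → Fin nC
    comp = proj₁ componentCount
    rep : Fin k → Dart G
    rep j = proj₁ (g-surj j)
    step : ∀ {d d′} → MapStep d d′ → g d ≡ g d′
    step (inj₁ refl) = sym (g-ρ _)
    step (inj₂ refl) = sym (g-rev _)
    inj : ∀ {i j} → comp (rep i) ≡ comp (rep j) → i ≡ j
    inj {i} {j} eq = trans (sym (proj₂ (g-surj i)))
      (trans (gfold isEquivalence g step (proj₁ (proj₂ (proj₂ componentCount) (rep i) (rep j)) eq))
             (proj₂ (g-surj j)))

  -- A spanning tree, a dual cotree and Euler's formula.

  module TreeCotree where
    module 𝕋 = Forest (spanningForest (λ e → vert (e , false)) (λ e → vert (e , true)) edges)
    -- The dual forest is grown only from the edges outside the primal one.
    module 𝕋* = Forest (spanningForest (λ e → face (e , false)) (λ e → face (e , true)) 𝕋.cotree)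

    rev-invariant : ∀ {k} (g : Dart G → Fin k) → (∀ e → g (e , false) ≡ g (e , true)) → ∀ d → g (rev G d) ≡ g d
    rev-invariant g eq (e , false) = sym (eq e)
    rev-invariant g eq (e , true)  = eq e

    c≤nC : 𝕋.c ≤ nC
    c≤nC = invariantLabels-≤ (𝕋.label ∘ vert) surj (cong 𝕋.label ∘ vert-ρ)
      (rev-invariant _ (λ e → 𝕋.label-const (∈-allFin e)))
      where
      surj : ∀ j → ∃ λ d → 𝕋.label (vert d) ≡ j
      surj j with v , refl ← 𝕋.label-surj j with d , refl ← proj₁ (proj₂ vertexCount) v = d , refl

    -- Evaluates a sum at one edge when `w` is the indicator of `e₀` wherever `z` does not vanish.
    -- It is applied once with `z` supported on the tree and once with `z` supported on the cotree.
    pick : ∀ {z w : Fin m → Bool} e₀ → (∀ e → z e ≡ false ⊎ w e ≡ eqFin e₀ e) →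
           ⨁ edges (λ e → z e ∧ w e) ≡ z e₀
    pick {z} {w} e₀ alt = trans (⨁-cong edges (λ e → help e (alt e))) (⨁-indicator e₀ z)
      where
      help : ∀ e → z e ≡ false ⊎ w e ≡ eqFin e₀ e → z e ∧ w e ≡ z e ∧ eqFin e₀ e
      help e (inj₁ ze) rewrite ze = refl
      help e (inj₂ we) = cong (z e ∧_) we

    -- A set of faces whose boundary uses only tree edges has empty boundary, because the
    -- tree edges are independent in the cut space; so the cotree edges connect the dual.
    label*-const : ∀ e → 𝕋*.label (face (e , false)) ≡ 𝕋*.label (face (e , true))
    label*-const e₀ with 𝕋.split (∈-allFin e₀)
    ... | inj₂ e₀∈B = 𝕋*.label-const e₀∈B
    ... | inj₁ e₀∈A = sym (eqFin-sound (trans (eqFin-sym _ _) (sym (trans (sym (eqFin-refl j)) (xor-false z-e₀)))))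
      where
      j = 𝕋*.label (face (e₀ , false))
      y : Fin nF → Bool
      y f = eqFin j (𝕋*.label f)
      x = proj₁ (𝕋.potential (eqFin e₀))
      alt : ∀ e → ∂ (y ∘ face) e ≡ false ⊎ ∂ (x ∘ vert) e ≡ eqFin e₀ e
      alt e with 𝕋.split (∈-allFin e)
      ... | inj₁ e∈A = inj₂ (proj₂ (𝕋.potential (eqFin e₀)) e∈A)
      ... | inj₂ e∈B = inj₁ (trans (cong (λ i → eqFin j i xor y (face (e , true))) (𝕋*.label-const e∈B)) (xor-same (y (face (e , true)))))
      z-e₀ : ∂ (y ∘ face) e₀ ≡ false
      z-e₀ = trans (sym (pick e₀ alt)) (trans (⨁-cong edges (λ e → ∧-comm (∂ (y ∘ face) e) _)) (orthogonal-labels x y))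

    c*≤nC : 𝕋*.c ≤ nC
    c*≤nC = invariantLabels-≤ g surj g-ρ g-rev
      where
      g : Dart G → Fin 𝕋*.c
      g = 𝕋*.label ∘ face
      g-rev : ∀ d → g (rev G d) ≡ g d
      g-rev = rev-invariant g label*-const
      g-ρ : ∀ d → g (ρ d) ≡ g d
      -- `ρ d` is `φ (rev G d)`, and both `φ` and `rev` preserve the dual label.
      g-ρ d = trans (cong (g ∘ ρ) (sym (rev-rev d))) (trans (cong 𝕋*.label (face-φ (rev G d))) (g-rev d))
      surj : ∀ j → ∃ λ d → g d ≡ j
      surj j with f , refl ← 𝕋*.label-surj j with d , refl ← proj₁ (proj₂ faceCount) f = d , refl

    -- Euler's formula leaves no room for a dual cycle among the cotree edges.
    cotree*-empty : length 𝕋*.cotree ≡ 0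
    cotree*-empty = ℕ.n≤0⇒n≡0 (ℕ.+-cancelˡ-≤ (t + (t* + 2 * nC)) b* 0 (begin
      (t + (t* + 2 * nC)) + b*         ≡⟨ lhs t t* b* nC ⟩
      (t + (t* + b*)) + 2 * nC         ≡⟨ cong (λ z → (t + z) + 2 * nC) 𝕋*.split-length ⟩
      (t + length 𝕋.cotree) + 2 * nC   ≡⟨ cong (_+ 2 * nC) (trans 𝕋.split-length (length-tabulate {n = m} id)) ⟩
      m + 2 * nC                       ≡⟨ euler ⟨
      nV + nF                          ≡⟨ cong₂ _+_ 𝕋.rank 𝕋*.rank ⟨
      (t + 𝕋.c) + (t* + 𝕋*.c)          ≤⟨ ℕ.+-mono-≤ (ℕ.+-monoʳ-≤ t c≤nC) (ℕ.+-monoʳ-≤ t* c*≤nC) ⟩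
      (t + nC) + (t* + nC)             ≡⟨ rhs t t* nC ⟩
      (t + (t* + 2 * nC)) + 0          ∎))
      where
      open ℕ.≤-Reasoning
      t = length 𝕋.tree
      t* = length 𝕋*.tree
      b* = length 𝕋*.cotree
      lhs : ∀ a b c d → (a + (b + 2 * d)) + c ≡ (a + (b + c)) + 2 * d
      lhs = solve-∀
      rhs : ∀ a b d → (a + d) + (b + d) ≡ (a + (b + 2 * d)) + 0
      rhs = solve-∀

    cotree⊆tree* : ∀ {e} → e ∈ 𝕋.cotree → e ∈ 𝕋*.tree
    cotree⊆tree* e∈B with 𝕋*.split e∈B
    ... | inj₁ e∈A* = e∈A*
    ... | inj₂ e∈B* with 𝕋*.cotree | cotree*-empty
    cotree⊆tree* e∈B | inj₂ () | [] | refl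

    -- Add the vertex cut that agrees with `s` on the tree. The remainder `s′` lives on the cotree
    -- and is still even on faces. Since the cotree is a dual forest, for each of its edges some set
    -- of faces has that edge as the only cotree edge in its boundary, so `s′` vanishes there.
    evenOnFaces⇒cut : ∀ s → (∀ y → ⟪ s , y ∘ face ⟫ ≡ false) → ∃ λ x → ∀ e → s e ≡ ∂ (x ∘ vert) e
    evenOnFaces⇒cut s s-even = x , λ e → xor-false (s′≡false e)
      where
      x = proj₁ (𝕋.potential s)
      s′ : Fin m → Bool
      s′ e = s e xor ∂ (x ∘ vert) e
      s′-tree : ∀ {e} → e ∈ 𝕋.tree → s′ e ≡ false
      s′-tree {e} e∈A = trans (cong (s e xor_) (proj₂ (𝕋.potential s) e∈A)) (xor-same (s e))
      s′-even : ∀ y → ⟪ s′ , y ∘ face ⟫ ≡ false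
      s′-even y = trans (⟪⟫-xor s _ (y ∘ face)) (cong₂ _xor_ (s-even y) (orthogonal-labels x y))
      s′≡false : ∀ e → s′ e ≡ false
      s′≡false e₀ = trans (sym (pick e₀ alt)) (s′-even y)
        where
        y = proj₁ (𝕋*.potential (eqFin e₀))
        alt : ∀ e → s′ e ≡ false ⊎ ∂ (y ∘ face) e ≡ eqFin e₀ e
        alt e with 𝕋.split (∈-allFin e)
        ... | inj₁ e∈A = inj₁ (s′-tree e∈A)
        ... | inj₂ e∈B = inj₂ (proj₂ (𝕋*.potential (eqFin e₀)) (cotree⊆tree* e∈B))

  open TreeCotree using (evenOnFaces⇒cut)

  -- Switching classes and face parities.

  cut⇒switching : ∀ (x : Fin nV → Bool) → ∃ λ vs → ∀ s e → switchSeq G vs s e ≡ s e xor ∂ (x ∘ vert) e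
  cut⇒switching x = vs , λ s e → trans (switchSeq-∂ vs s e)
      (cong (s e xor_) (cong₂ _xor_ (at (e , false)) (at (e , true))))
    where
    rep : Fin nV → Dart G
    rep j = proj₁ (proj₁ (proj₂ vertexCount) j)
    vert-rep : ∀ j → vert (rep j) ≡ j
    vert-rep j = proj₂ (proj₁ (proj₂ vertexCount) j)
    -- One switch at the vertex of each label in `x`.
    vs = map (tail G ∘ rep) (filterᵇ x (allFin nV))
    at : ∀ d → ⨁ vs (λ v → eqFin v (tail G d)) ≡ x (vert d)
    at d = begin
      ⨁ vs (λ v → eqFin v (tail G d))
        ≡⟨ ⨁-map (tail G ∘ rep) (filterᵇ x (allFin nV)) _ ⟩
      ⨁ (filterᵇ x (allFin nV)) (λ j → eqFin (tail G (rep j)) (tail G d))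
        ≡⟨ ⨁-filter x (allFin nV) _ ⟩
      ⨁ (allFin nV) (λ j → x j ∧ eqFin (tail G (rep j)) (tail G d))
        ≡⟨ ⨁-cong (allFin nV) (λ j → cong (x j ∧_) (⌊⌋-cong (tail G (rep j) F.≟ tail G d) (vert d F.≟ j)
             (λ eq → trans (sym (tail⇒vert eq)) (vert-rep j))
             (λ { refl → vert⇒tail (vert-rep (vert d)) }))) ⟩
      ⨁ (allFin nV) (λ j → x j ∧ eqFin (vert d) j)
        ≡⟨ ⨁-indicator (vert d) x ⟩
      x (vert d) ∎
      where open ≡-Reasoning

  -- The parity of the dual degree of `f` in `s`; an edge with `f` on both sides contributes
  -- nothing.
  parity : (Fin m → Bool) → Fin nF → Bool
  parity s f = ⟪ s , eqFin f ∘ face ⟫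

  -- By linearity, since a set of faces is the sum of its members.
  ⟪⟫-parity : ∀ s y → ⟪ s , y ∘ face ⟫ ≡ ⨁ (allFin nF) (λ f → y f ∧ parity s f)
  ⟪⟫-parity s y = sym (begin
    ⨁ fs (λ f → y f ∧ ⨁ edges (λ e → s e ∧ ∂ (eqFin f ∘ face) e))
      ≡⟨ ⨁-cong fs (λ f → ⨁-∧ edges (y f) _) ⟨
    ⨁ fs (λ f → ⨁ edges (λ e → y f ∧ (s e ∧ ∂ (eqFin f ∘ face) e)))
      ≡⟨ ⨁-swap fs edges _ ⟩
    ⨁ edges (λ e → ⨁ fs (λ f → y f ∧ (s e ∧ ∂ (eqFin f ∘ face) e)))
      ≡⟨ ⨁-cong edges (λ e → ⨁-cong fs (λ f → rearrange (y f) (s e) _ _)) ⟩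
    ⨁ edges (λ e → ⨁ fs (λ f → s e ∧ ((y f ∧ eqFin f (face (e , false))) xor (y f ∧ eqFin f (face (e , true))))))
      ≡⟨ ⨁-cong edges (λ e → trans (⨁-∧ fs (s e) _) (cong (s e ∧_) (trans (⨁-xor fs _ _)
           (cong₂ _xor_ (at (face (e , false))) (at (face (e , true))))))) ⟩
    ⟪ s , y ∘ face ⟫ ∎)
    where
    open ≡-Reasoning
    fs = allFin nF
    rearrange : ∀ a b p q → a ∧ (b ∧ (p xor q)) ≡ b ∧ ((a ∧ p) xor (a ∧ q))
    rearrange false b p q = sym (∧-zeroʳ b)
    rearrange true  b p q = refl
    at : ∀ a → ⨁ fs (λ f → y f ∧ eqFin f a) ≡ y a
    at a = trans (⨁-cong fs (λ f → cong (y f ∧_) (eqFin-sym f a))) (⨁-indicator a y)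

  -- Switching adds a vertex cut, which is orthogonal to every set of faces.
  switching-⟪⟫ : ∀ vs s y → ⟪ switchSeq G vs s , y ∘ face ⟫ ≡ ⟪ s , y ∘ face ⟫
  switching-⟪⟫ vs s y = trans (⟪⟫-cong (y ∘ face) (switchSeq-∂ vs s)) (trans (⟪⟫-xor s _ (y ∘ face))
    (trans (cong (⟪ s , y ∘ face ⟫ xor_) (orthogonal (λ d → cong (λ v → ⨁ vs (λ w → eqFin w v)) (ρ-tail d)) (cong y ∘ face-φ)))
      (xor-identityʳ _)))

  -- The sum of `s` and `t` is even on every set of faces, hence a vertex cut, and a vertex cut is
  -- added by switching.
  sameParity⇒switching : ∀ s t → (∀ f → parity t f ≡ parity s f) → ∃ λ vs → ∀ e → switchSeq G vs s e ≡ t e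
  sameParity⇒switching s t eq
    with x , s+t≡∂x ← evenOnFaces⇒cut (λ e → s e xor t e) (λ y → trans (⟪⟫-xor s t (y ∘ face))
           (trans (cong (_xor ⟪ t , y ∘ face ⟫) (trans (⟪⟫-parity s y)
             (trans (⨁-cong (allFin nF) (λ f → cong (y f ∧_) (sym (eq f)))) (sym (⟪⟫-parity t y)))))
             (xor-same ⟪ t , y ∘ face ⟫)))
    with vs , vs-x ← cut⇒switching x
    = vs , λ e → trans (vs-x s e) (trans (cong (s e xor_) (sym (s+t≡∂x e)))
        (trans (sym (xor-assoc (s e) _ _)) (cong (_xor t e) (xor-same (s e)))))

-- Iterates of a map.

iter-+ : ∀ {A : Set} (f : A → A) i j x → iter f (i + j) x ≡ iter f i (iter f j x)
iter-+ f zero    j x = refl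
iter-+ f (suc i) j x = cong f (iter-+ f i j x)

iter-suc : ∀ {A : Set} (f : A → A) i x → iter f (suc i) x ≡ iter f i (f x)
iter-suc f zero    x = refl
iter-suc f (suc i) x = cong f (iter-suc f i x)

leastHit : ∀ {A : Set} (_≟_ : (x y : A) → Dec (x ≡ y)) (f : A → A) {x y} i → iter f i x ≡ y →
           ∃ λ k → iter f k x ≡ y × ∀ {j} → j < k → iter f j x ≢ y
leastHit _≟_ f zero    hit = 0 , hit , λ ()
leastHit _≟_ f {x} {y} (suc i) hit with x ≟ y
... | yes x≡y = 0 , x≡y , λ ()
... | no x≢y with k , hit′ , least ← leastHit _≟_ f {f x} i (trans (sym (iter-suc f i x)) hit)
  = suc k , trans (iter-suc f k x) hit′ , λ { {zero} _ → x≢y ; {suc j} (s≤s j<k) eq → least j<k (trans (sym (iter-suc f j x)) eq) }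

-- Minimum signatures, odd dual cuts and decompositions.

module Critical (G : SignedGraph) (P : PlaneEmbedding G) (crit : CriticallyFrustrated G 3) where
  open SignedGraph G
  open PlaneEmbedding P
  open Darts G
  open Plane G P

  -- The indicator of the set T of negative faces.
  odd : Fin nF → Bool
  odd = parity neg

  switched : List (Fin n) → Fin m → Bool
  switched vs = switchSeq G vs neg

  -- `J` is a T-join, hence the negative edge set of a signature equivalent to `neg`, and such a set
  -- has at least three edges.
  join-≥3 : ∀ J → (∀ f → parity J f ≡ odd f) → 3 ≤ countB J edges
  join-≥3 J eq with vs , vs-J ← sameParity⇒switching neg J eq =
    ℕ.≤-trans (proj₂ (proj₁ crit) vs) (ℕ.≤-reflexive (countB-cong edges vs-J))

  -- A signature with two negative edges after deletion of `e` has two or three in the whole graph.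
  -- Two would contradict the frustration index, so `e` is negative.
  minimumThrough : ∀ e → ∃ λ vs → switched vs e ≡ true × countB (switched vs) edges ≡ 3
  minimumThrough e with vs , two ← proj₁ (proj₂ crit e refl) =
    vs , help (switched vs e) refl
    where
    total : 𝟙 (switched vs e) + 2 ≡ countB (switched vs) edges
    total = trans (cong (𝟙 (switched vs e) +_) (sym two)) (countB-delete e (switched vs))
    help : ∀ b → switched vs e ≡ b → switched vs e ≡ true × countB (switched vs) edges ≡ 3
    help true  eq = eq , trans (sym total) (cong (λ z → 𝟙 z + 2) eq)
    help false eq = contradiction (proj₂ (proj₁ crit) vs)
      (ℕ.<⇒≱ (s≤s (ℕ.≤-reflexive (trans (sym total) (cong (λ z → 𝟙 z + 2) eq)))))

  -- Switching preserves the parity on a cut of the dual, and an odd number is not zero.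
  oddCut-hit : ∀ (X : Fin nF → Bool) → ⟪ neg , X ∘ face ⟫ ≡ true → ∀ vs →
               ∃ λ e → switched vs e ≡ true × ∂ (X ∘ face) e ≡ true
  oddCut-hit X X-odd vs with e , _ , eq ← ⨁-witness edges (trans (switching-⟪⟫ vs neg X) X-odd) = e , ∧-true eq

  -- A signature with three negative edges meets both lower bounds with equality. One in which `e`
  -- is negative then shows that deleting `e` lowers the frustration of the part.
  critical-part : ∀ (S S′ : EdgeSet G) k k′ → k + k′ ≡ 3 →
                  (∀ s → negCount G S s + negCount G S′ s ≡ countB s edges) →
                  (∀ vs → k ≤ negCount G S (switched vs)) → (∀ vs → k′ ≤ negCount G S′ (switched vs)) →
                  CritFrustSub G S k
  critical-part S S′ k k′ k+k′≡3 parts k≤ k′≤ =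
    (attained , k≤) , deleted
    where
    tight : ∀ vs → countB (switched vs) edges ≡ 3 → negCount G S (switched vs) ≡ k
    tight vs three = ℕ.≤-antisym (ℕ.+-cancelʳ-≤ k′ _ _ (begin
      negCount G S (switched vs) + k′                          ≤⟨ ℕ.+-monoʳ-≤ _ (k′≤ vs) ⟩
      negCount G S (switched vs) + negCount G S′ (switched vs) ≡⟨ parts (switched vs) ⟩
      countB (switched vs) edges                               ≡⟨ three ⟩
      3                                                        ≡⟨ k+k′≡3 ⟨
      k + k′                                                   ∎)) (k≤ vs)
      where open ℕ.≤-Reasoning
    attained : ∃ λ vs → negCount G S (switched vs) ≡ k
    attained with vs , three ← proj₁ (proj₁ crit) = vs , tight vs three
    delete : ∀ e s → 𝟙 (S e ∧ s e) + negCount G (deleteEdge G e S) s ≡ negCount G S s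
    delete e s = trans (cong (𝟙 (S e ∧ s e) +_) (countB-cong edges (λ x → swap∧ (S x) (not (eqFin e x)) (s x))))
                       (countB-delete e (λ x → S x ∧ s x))
      where
      swap∧ : ∀ a b c → (a ∧ b) ∧ c ≡ b ∧ (a ∧ c)
      swap∧ a b c = trans (cong (_∧ c) (∧-comm a b)) (∧-assoc b a c)
    deleted : ∀ e → S e ≡ true → Frustration G (deleteEdge G e S) (k ∸ 1)
    deleted e Se with vs , neg-e , three ← minimumThrough e =
      (vs , cong (_∸ 1) (trans (sym (cong (λ b → 𝟙 b + negCount G (deleteEdge G e S) (switched vs)) (cong₂ _∧_ Se neg-e)))
                               (trans (delete e (switched vs)) (tight vs three)))) ,
      -- Deleting `e` removes at most one negative edge.
      λ ws → ℕ.m≤n+o⇒m∸n≤o k 1 (ℕ.≤-trans (k≤ ws) (ℕ.≤-trans (ℕ.≤-reflexive (sym (delete e (switched ws))))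
               (ℕ.+-monoˡ-≤ _ (𝟙≤1 (S e ∧ switched ws e)))))
      where
      𝟙≤1 : ∀ b → 𝟙 b ≤ 1
      𝟙≤1 true  = s≤s z≤n
      𝟙≤1 false = z≤n

  -- Every signature meets the odd cut δ(a), and meets its complement at least twice: an edge
  -- found in one of the cuts X i is missed by another one.  Since 1 + 2 = 3, both parts are critical.
  decompose : ∀ a → odd a ≡ true → {I : Set} → I → (X : I → Fin nF → Bool) →
              (∀ i → ⟪ neg , X i ∘ face ⟫ ≡ true) →
              (∀ i e → ∂ (X i ∘ face) e ≡ true → ∂ (eqFin a ∘ face) e ≡ false) →
              (∀ e → ∃ λ i → ∂ (X i ∘ face) e ≡ false) →
              Decomposable G 3
  decompose a a-odd {I} i₀ X X-odd avoid miss =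
    2 , s≤s (s≤s z≤n) , ks , (λ { zero → s≤s z≤n ; (suc zero) → s≤s z≤n }) , refl , part ,
    λ { zero → critical-part S₁ S₂ 1 2 refl parts₁ ≥1 ≥2
      ; (suc zero) → critical-part S₂ S₁ 2 1 refl (λ s → trans (ℕ.+-comm (negCount G S₂ s) _) (parts₁ s)) ≥2 ≥1 }
    where
    ks : Fin 2 → ℕ
    ks zero       = 1
    ks (suc zero) = 2
    part : Fin m → Fin 2
    part e = if ∂ (eqFin a ∘ face) e then zero else suc zero
    S₁ S₂ : EdgeSet G
    S₁ e = eqFin (part e) zero
    S₂ e = eqFin (part e) (suc zero)
    S₁≡ : ∀ e → S₁ e ≡ ∂ (eqFin a ∘ face) e
    S₁≡ e with ∂ (eqFin a ∘ face) e
    ... | true  = refl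
    ... | false = refl
    S₂≡ : ∀ e → S₂ e ≡ not (∂ (eqFin a ∘ face) e)
    S₂≡ e with ∂ (eqFin a ∘ face) e
    ... | true  = refl
    ... | false = refl
    parts₁ : ∀ s → negCount G S₁ s + negCount G S₂ s ≡ countB s edges
    parts₁ s = trans (cong₂ _+_ (countB-cong edges (λ e → cong (_∧ s e) (S₁≡ e))) (countB-cong edges (λ e → cong (_∧ s e) (S₂≡ e))))
                     (countB-split s (∂ (eqFin a ∘ face)) edges)
    ≥1 : ∀ vs → 1 ≤ negCount G S₁ (switched vs)
    ≥1 vs with e , neg-e , e∈δ ← oddCut-hit (eqFin a) a-odd vs =
      countB-≥1 (∈-allFin e) (cong₂ _∧_ (trans (S₁≡ e) e∈δ) neg-e)
    hit : ∀ i vs → ∃ λ e → S₂ e ∧ switched vs e ≡ true × ∂ (X i ∘ face) e ≡ true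
    hit i vs with e , neg-e , e∈δ ← oddCut-hit (X i) (X-odd i) vs =
      e , cong₂ _∧_ (trans (S₂≡ e) (cong not (avoid i e e∈δ))) neg-e , e∈δ
    ≥2 : ∀ vs → 2 ≤ negCount G S₂ (switched vs)
    ≥2 vs with e , p , _ ← hit i₀ vs with i , e∉δ ← miss e with e′ , p′ , e′∈δ ← hit i vs =
      countB-≥2 (∈-allFin e) (∈-allFin e′) (λ { refl → contradiction (trans (sym e′∈δ) e∉δ) λ () }) p p′

  -- Adjacency in the dual, and decompositions when two or four faces are odd.

  Joins : Fin m → Fin nF → Fin nF → Set
  Joins e a b = (face (e , false) ≡ a × face (e , true) ≡ b) ⊎ (face (e , false) ≡ b × face (e , true) ≡ a)

  Adjacent : Fin nF → Fin nF → Set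
  Adjacent a b = ∃ λ e → Joins e a b

  adjacent? : ∀ a b → Dec (Adjacent a b)
  adjacent? a b = any? λ e →
    ((face (e , false) F.≟ a) ×-dec (face (e , true) F.≟ b)) ⊎-dec
    ((face (e , false) F.≟ b) ×-dec (face (e , true) F.≟ a))

  joins-sym : ∀ {e a b} → Joins e a b → Joins e b a
  joins-sym (inj₁ p) = inj₂ p
  joins-sym (inj₂ p) = inj₁ p

  ∂-joins : ∀ {e a b} → Joins e a b → ∀ (y : Fin nF → Bool) → ∂ (y ∘ face) e ≡ y a xor y b
  ∂-joins (inj₁ (refl , refl)) y = refl
  ∂-joins (inj₂ (refl , refl)) y = xor-comm (y _) (y _)

  cut-joins : ∀ {e a} → ∂ (eqFin a ∘ face) e ≡ true → ∃ λ b → Joins e a b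
  cut-joins {e} {a} e∈δ with a F.≟ face (e , false) | a F.≟ face (e , true)
  ... | yes refl | _        = _ , inj₁ (refl , refl)
  ... | no _     | yes refl = _ , inj₂ (refl , refl)
  cut-joins () | no _ | no _

  -- An edge common to both cuts would join `a` and `b`.
  nonadjacent-avoid : ∀ {a b} → a ≢ b → ¬ Adjacent a b → ∀ {e} →
                      ∂ (eqFin b ∘ face) e ≡ true → ∂ (eqFin a ∘ face) e ≡ false
  nonadjacent-avoid {a} a≢b ¬ab {e} e∈δb with v , bv ← cut-joins e∈δb =
    trans (∂-joins bv (eqFin a)) (trans (cong (_xor eqFin a v) (eqFin-≢ a≢b))
      (eqFin-≢ λ { refl → ¬ab (e , joins-sym bv) }))

  parity-edge : ∀ {e a b} → Joins e a b → ∀ f → parity (eqFin e) f ≡ eqFin f a xor eqFin f b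
  parity-edge {e} ab f = trans (⟪⟫-edge e (eqFin f ∘ face)) (∂-joins ab (eqFin f))

  countB-edge : ∀ e → countB (eqFin e) edges ≡ 1
  countB-edge e = trans (countB-cong edges (λ x → sym (∧-identityʳ (eqFin e x)))) (countB-eqFin e (λ _ → true))

  -- Such an edge would by itself be a T-join.
  noEdgeJoin : ∀ {a b} → (∀ f → eqFin f a xor eqFin f b ≡ odd f) → ¬ Adjacent a b
  noEdgeJoin odd≡ (e , ab) = contradiction (join-≥3 (eqFin e) (λ f → trans (parity-edge ab f) (odd≡ f)))
    (ℕ.<⇒≱ (s≤s (ℕ.≤-trans (ℕ.≤-reflexive (countB-edge e)) (s≤s z≤n))))

  -- The two edges would form a T-join of size at most two. The pairs may share a face, which then
  -- cancels; this covers dual paths of length two.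
  noPairJoin : ∀ {a b c d} → (∀ f → (eqFin f a xor eqFin f b) xor (eqFin f c xor eqFin f d) ≡ odd f) →
               Adjacent a b → ¬ Adjacent c d
  noPairJoin odd≡ (e , ab) (e′ , cd) = contradiction
    (join-≥3 (λ x → eqFin e x xor eqFin e′ x) (λ f → trans (⟪⟫-xor (eqFin e) (eqFin e′) (eqFin f ∘ face))
      (trans (cong₂ _xor_ (parity-edge ab f) (parity-edge cd f)) (odd≡ f))))
    (ℕ.<⇒≱ (s≤s (ℕ.≤-trans (countB-xor-≤ (eqFin e) (eqFin e′) edges)
      (ℕ.≤-reflexive (cong₂ _+_ (countB-edge e) (countB-edge e′))))))

  -- The cuts are δ(b) and δ(N), where `N` is the closed neighbourhood of `a` in the dual. No edge
  -- of δ(a) leaves `N`. A dual path of length at most two from `a` to `b` would be a T-join that is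
  -- too small, so neither `b` nor any neighbour of `b` lies in `N`; hence δ(N) is odd and disjoint
  -- from δ(b).
  twoOdd : ∀ {a b} → a ≢ b → odd a ≡ true → odd b ≡ true →
           (∀ f → eqFin f a xor eqFin f b ≡ odd f) → Decomposable G 3
  twoOdd {a} {b} a≢b a-odd b-odd odd≡ =
    decompose a a-odd true X X-odd avoid miss
    where
    ¬ab = noEdgeJoin odd≡
    N : Fin nF → Bool
    N f = eqFin a f ∨ ⌊ adjacent? a f ⌋
    Na : N a ≡ true
    Na = cong (_∨ ⌊ adjacent? a a ⌋) (eqFin-refl a)
    N-adjacent : ∀ {f} → Adjacent a f → N f ≡ true
    N-adjacent {f} af with eqFin a f
    ... | true  = refl
    ... | false = ⌊⌋-true (adjacent? a f) af
    N-false : ∀ {f} → a ≢ f → ¬ Adjacent a f → N f ≡ false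
    N-false {f} a≢f ¬af = cong₂ _∨_ (eqFin-≢ a≢f) (⌊⌋-false (adjacent? a f) ¬af)
    X : Bool → Fin nF → Bool
    X true  = eqFin b
    X false = N
    X-odd : ∀ i → ⟪ neg , X i ∘ face ⟫ ≡ true
    X-odd true  = b-odd
    X-odd false = begin
      ⟪ neg , N ∘ face ⟫
        ≡⟨ ⟪⟫-parity neg N ⟩
      ⨁ (allFin nF) (λ f → N f ∧ odd f)
        ≡⟨ ⨁-cong (allFin nF) (λ f → trans (cong (N f ∧_) (sym (trans (cong₂ _xor_ (eqFin-sym a f) (eqFin-sym b f)) (odd≡ f))))
             (∧-distribˡ-xor (N f) _ _)) ⟩
      ⨁ (allFin nF) (λ f → (N f ∧ eqFin a f) xor (N f ∧ eqFin b f))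
        ≡⟨ ⨁-xor (allFin nF) _ _ ⟩
      ⨁ (allFin nF) (λ f → N f ∧ eqFin a f) xor ⨁ (allFin nF) (λ f → N f ∧ eqFin b f)
        ≡⟨ cong₂ _xor_ (⨁-indicator a N) (⨁-indicator b N) ⟩
      N a xor N b
        ≡⟨ cong₂ _xor_ Na (N-false a≢b ¬ab) ⟩
      true ∎
      where open ≡-Reasoning
    avoid : ∀ i e → ∂ (X i ∘ face) e ≡ true → ∂ (eqFin a ∘ face) e ≡ false
    avoid true  e e∈δ = nonadjacent-avoid a≢b ¬ab e∈δ
    avoid false e e∈δ = help (∂ (eqFin a ∘ face) e) refl
      where
      help : ∀ z → ∂ (eqFin a ∘ face) e ≡ z → ∂ (eqFin a ∘ face) e ≡ false
      help false eq = eq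
      help true  eq with v , av ← cut-joins eq = contradiction
        (trans (sym e∈δ) (trans (∂-joins av N) (cong₂ _xor_ Na (N-adjacent (e , av))))) λ ()
    miss : ∀ e → ∃ λ i → ∂ (X i ∘ face) e ≡ false
    miss e = help (∂ (eqFin b ∘ face) e) refl
      where
      help : ∀ z → ∂ (eqFin b ∘ face) e ≡ z → ∃ λ i → ∂ (X i ∘ face) e ≡ false
      help false eq = true , eq
      help true  eq with v , bv ← cut-joins eq = false ,
        trans (∂-joins bv N) (cong₂ _xor_ (N-false a≢b ¬ab)
          (N-false (λ { refl → ¬ab (e , joins-sym bv) })
            (λ av → noPairJoin (λ f → trans (xor-telescope (eqFin f a) (eqFin f v) _) (odd≡ f)) av (e , joins-sym bv))))

  -- The cuts δ(b) and δ(c) avoid δ(a), and a common edge of the two would join `b` and `c`.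
  pairwiseNonadjacent : ∀ {a b c} → a ≢ b → a ≢ c → b ≢ c → odd a ≡ true → odd b ≡ true → odd c ≡ true →
                        ¬ Adjacent a b → ¬ Adjacent a c → ¬ Adjacent b c → Decomposable G 3
  pairwiseNonadjacent {a} {b} {c} a≢b a≢c b≢c a-odd b-odd c-odd ¬ab ¬ac ¬bc =
    decompose a a-odd true X (λ { true → b-odd ; false → c-odd })
      (λ { true e → nonadjacent-avoid a≢b ¬ab ; false e → nonadjacent-avoid a≢c ¬ac }) miss
    where
    X : Bool → Fin nF → Bool
    X true  = eqFin b
    X false = eqFin c
    miss : ∀ e → ∃ λ i → ∂ (X i ∘ face) e ≡ false
    miss e with ∂ (eqFin c ∘ face) e in eq
    ... | false = false , eq
    ... | true  = true , nonadjacent-avoid b≢c ¬bc eq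

  -- The cuts δ(b), δ(c) and δ(d) avoid δ(a), and an edge, having only two sides, lies in at most
  -- two of them.
  isolated : ∀ {a b c d} → a ≢ b → a ≢ c → a ≢ d → b ≢ c → b ≢ d → c ≢ d →
             odd a ≡ true → odd b ≡ true → odd c ≡ true → odd d ≡ true →
             ¬ Adjacent a b → ¬ Adjacent a c → ¬ Adjacent a d → Decomposable G 3
  isolated {a} {b} {c} {d} a≢b a≢c a≢d b≢c b≢d c≢d a-odd b-odd c-odd d-odd ¬ab ¬ac ¬ad =
    decompose a a-odd zero X (λ { zero → b-odd ; (suc zero) → c-odd ; (suc (suc zero)) → d-odd })
      (λ { zero e → nonadjacent-avoid a≢b ¬ab ; (suc zero) e → nonadjacent-avoid a≢c ¬ac
         ; (suc (suc zero)) e → nonadjacent-avoid a≢d ¬ad }) miss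
    where
    X : Fin 3 → Fin nF → Bool
    X zero             = eqFin b
    X (suc zero)       = eqFin c
    X (suc (suc zero)) = eqFin d
    miss : ∀ e → ∃ λ i → ∂ (X i ∘ face) e ≡ false
    miss e with ∂ (eqFin b ∘ face) e in eqb
    ... | false = zero , eqb
    ... | true with v , bv ← cut-joins eqb with c F.≟ v
    ...   | no c≢v   = suc zero , trans (∂-joins bv (eqFin c)) (cong₂ _xor_ (eqFin-≢ (b≢c ∘ sym)) (eqFin-≢ c≢v))
    ...   | yes refl = suc (suc zero) , trans (∂-joins bv (eqFin d)) (cong₂ _xor_ (eqFin-≢ (b≢d ∘ sym)) (eqFin-≢ (c≢d ∘ sym)))

  -- The non-adjacent pairs meet each of the three perfect matchings of {a , b , c , d},
  -- so they contain a triangle or a star.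
  fourOdd : ∀ {a b c d} → a ≢ b → a ≢ c → a ≢ d → b ≢ c → b ≢ d → c ≢ d →
            odd a ≡ true → odd b ≡ true → odd c ≡ true → odd d ≡ true →
            (∀ f → (eqFin f a xor eqFin f b) xor (eqFin f c xor eqFin f d) ≡ odd f) → Decomposable G 3
  fourOdd {a} {b} {c} {d} a≢b a≢c a≢d b≢c b≢d c≢d oa ob oc od odd≡ =
    cases (missing odd≡)
          (missing (λ f → trans (interchange (eqFin f a) _ _ _) (odd≡ f)))
          (missing (λ f → trans (interchange (eqFin f a) _ _ _)
            (trans (cong ((eqFin f a xor eqFin f b) xor_) (xor-comm (eqFin f d) _)) (odd≡ f))))
    where
    -- If both pairs were adjacent, their edges would form a T-join of size at most two.
    missing : ∀ {p q r s} → (∀ f → (eqFin f p xor eqFin f q) xor (eqFin f r xor eqFin f s) ≡ odd f) →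
              ¬ Adjacent p q ⊎ ¬ Adjacent r s
    missing {p} {q} eq with adjacent? p q
    ... | yes pq = inj₂ (noPairJoin eq pq)
    ... | no ¬pq = inj₁ ¬pq
    flip : ∀ {p q} → ¬ Adjacent p q → ¬ Adjacent q p
    flip ¬pq (e , qp) = ¬pq (e , joins-sym qp)
    cases : ¬ Adjacent a b ⊎ ¬ Adjacent c d → ¬ Adjacent a c ⊎ ¬ Adjacent b d → ¬ Adjacent a d ⊎ ¬ Adjacent b c →
            Decomposable G 3
    cases (inj₁ ab) (inj₁ ac) (inj₁ ad) = isolated a≢b a≢c a≢d b≢c b≢d c≢d oa ob oc od ab ac ad
    cases (inj₁ ab) (inj₁ ac) (inj₂ bc) = pairwiseNonadjacent a≢b a≢c b≢c oa ob oc ab ac bc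
    cases (inj₁ ab) (inj₂ bd) (inj₁ ad) = pairwiseNonadjacent a≢b a≢d b≢d oa ob od ab ad bd
    cases (inj₁ ab) (inj₂ bd) (inj₂ bc) =
      isolated (a≢b ∘ sym) b≢c b≢d a≢c a≢d c≢d ob oa oc od (flip ab) bc bd
    cases (inj₂ cd) (inj₁ ac) (inj₁ ad) = pairwiseNonadjacent a≢c a≢d c≢d oa oc od ac ad cd
    cases (inj₂ cd) (inj₁ ac) (inj₂ bc) =
      isolated (a≢c ∘ sym) (b≢c ∘ sym) c≢d a≢b a≢d b≢d oc oa ob od (flip ac) (flip bc) cd
    cases (inj₂ cd) (inj₂ bd) (inj₁ ad) =
      isolated (a≢d ∘ sym) (b≢d ∘ sym) (c≢d ∘ sym) a≢b a≢c b≢c od oa ob oc (flip ad) (flip bd) (flip cd)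
    cases (inj₂ cd) (inj₂ bd) (inj₂ bc) = pairwiseNonadjacent b≢c b≢d c≢d ob oc od bc bd cd

  -- Incidences of negative edges with faces, and the number of odd faces.

  degree : (Fin m → Bool) → Fin nF → ℕ
  degree s f = countB (λ d → eqFin f (face d) ∧ s (proj₁ d)) (darts G)

  odd?-degree : ∀ s f → odd? (degree s f) ≡ parity s f
  odd?-degree s f = trans (odd?-countB _ (darts G)) (⟪⟫-darts s (eqFin f ∘ face))

  -- Switching preserves the parity of the degree, and an odd degree is at least one.
  odd≤degree : ∀ vs f → 𝟙 (odd f) ≤ degree (switched vs) f
  odd≤degree vs f with odd f in eq
  ... | false = z≤n
  ... | true with degree (switched vs) f | trans (odd?-degree (switched vs) f) (trans (switching-⟪⟫ vs neg (eqFin f)) eq)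
  ...   | suc _ | _ = s≤s z≤n

  -- Every edge has two darts, each on one face; an edge with the same face on both sides counts
  -- twice there.
  ∑-degree : ∀ s → countB s edges ≡ 3 → ∑ (allFin nF) (degree s) ≡ 6
  ∑-degree s three = trans (∑-fibres face (s ∘ proj₁) (darts G)) (trans (countB-darts s) (cong₂ _+_ three three))

  oddFaces : List (Fin nF)
  oddFaces = filterᵇ odd (allFin nF)

  oddFaces-odd : ∀ {f} → f ∈ oddFaces → odd f ≡ true
  oddFaces-odd f∈ = Equivalence.to T-≡ (proj₂ (∈-filter⁻ (T? ∘ odd) {xs = allFin nF} f∈))

  -- Writes T as the sum of its members, so that matching on the list yields the hypothesis of
  -- `twoOdd` and `fourOdd`.
  odd-⨁ : ∀ f → ⨁ oddFaces (eqFin f) ≡ odd f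
  odd-⨁ f = trans (⨁-filter odd (allFin nF) (eqFin f)) (⨁-indicator f odd)

  -- A minimum signature has six incidences with faces, and every odd face takes at least one of
  -- them.
  |oddFaces|≤6 : length oddFaces ≤ 6
  |oddFaces|≤6 with vs , three ← proj₁ (proj₁ crit) = begin
    length oddFaces                          ≡⟨ trans (countB-filter odd (allFin nF)) (countB-∑ odd (allFin nF)) ⟩
    ∑ (allFin nF) (𝟙 ∘ odd)                   ≤⟨ ∑-mono (allFin nF) (odd≤degree vs) ⟩
    ∑ (allFin nF) (degree (switched vs))      ≡⟨ ∑-degree (switched vs) three ⟩
    6                                         ∎
    where open ℕ.≤-Reasoning

  -- The set of all faces has empty boundary, so `neg` is even on it.
  |oddFaces|-even : odd? (length oddFaces) ≡ false
  |oddFaces|-even = begin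
    odd? (length oddFaces)          ≡⟨ cong odd? (countB-filter odd (allFin nF)) ⟩
    odd? (countB odd (allFin nF))   ≡⟨ odd?-countB odd (allFin nF) ⟩
    ⨁ (allFin nF) odd               ≡⟨ ⟪⟫-parity neg (λ _ → true) ⟨
    ⟪ neg , (λ _ → true) ⟫          ≡⟨ ⨁-cong edges (λ e → ∧-zeroʳ (neg e)) ⟩
    ⨁ edges (λ _ → false)           ≡⟨ ⨁-false edges ⟩
    false                           ∎
    where open ≡-Reasoning

  -- The bound and the parity leave zero, two, four or six odd faces. With none, the empty set would
  -- be a T-join; with two or four there is a decomposition.
  sixOdd : ¬ Decomposable G 3 → length oddFaces ≡ 6
  sixOdd ¬dec = cases oddFaces |oddFaces|≤6 |oddFaces|-even (filter⁺ (T? ∘ odd) (allFin⁺ nF)) oddFaces-odd odd-⨁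
    where
    cases : ∀ fs → length fs ≤ 6 → odd? (length fs) ≡ false → Unique fs → (∀ {f} → f ∈ fs → odd f ≡ true) →
            (∀ f → ⨁ fs (eqFin f) ≡ odd f) → length fs ≡ 6
    cases [] _ _ _ _ odd≡ = contradiction
      (join-≥3 (λ _ → false) (λ f → trans (⨁-false edges) (odd≡ f))) (ℕ.<⇒≱ (subst (_< 3) (sym none) (s≤s z≤n)))
      where
      none : countB (λ _ → false) edges ≡ 0
      none = go edges
        where
        go : ∀ es → countB {A = Fin m} (λ _ → false) es ≡ 0
        go []       = refl
        go (_ ∷ es) = go es
    cases (a ∷ b ∷ []) _ _ ((a≢b ∷ []) ∷ _) is-odd odd≡ = contradiction
      (twoOdd a≢b (is-odd (here refl)) (is-odd (there (here refl)))
        (λ f → trans (cong (eqFin f a xor_) (sym (xor-identityʳ (eqFin f b)))) (odd≡ f))) ¬dec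
    cases (a ∷ b ∷ c ∷ d ∷ []) _ _ ((a≢b ∷ a≢c ∷ a≢d ∷ []) ∷ (b≢c ∷ b≢d ∷ []) ∷ (c≢d ∷ []) ∷ _) is-odd odd≡ = contradiction
      (fourOdd a≢b a≢c a≢d b≢c b≢d c≢d (is-odd (here refl)) (is-odd (there (here refl)))
        (is-odd (there (there (here refl)))) (is-odd (there (there (there (here refl)))))
        (λ f → trans (xor-assoc (eqFin f a) _ _)
          (trans (cong (λ z → eqFin f a xor (eqFin f b xor (eqFin f c xor z))) (sym (xor-identityʳ (eqFin f d)))) (odd≡ f)))) ¬dec
    cases (_ ∷ _ ∷ _ ∷ _ ∷ _ ∷ _ ∷ []) _ _ _ _ _ = refl
    cases (_ ∷ _ ∷ _ ∷ _ ∷ _ ∷ _ ∷ _ ∷ _) (s≤s (s≤s (s≤s (s≤s (s≤s (s≤s ())))))) _ _ _ _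

  -- Signs of facial walks.

  walk : (Fin m → Bool) → ℕ → Dart G → Bool
  walk s zero    d = false
  walk s (suc i) d = walk s i d xor s (proj₁ (iter φ i d))

  -- Switching adds to each step the difference of a vertex potential between its ends. Along the
  -- walk these differences telescope, and they cancel when it is closed.
  walk-switch : ∀ vs s i d → tail G d ≡ tail G (iter φ i d) → walk (switchSeq G vs s) i d ≡ walk s i d
  walk-switch vs s i d closed = trans (go i) (trans (cong (walk s i d xor_)
      (trans (cong (λ v → x (tail G d) xor x v) (sym closed)) (xor-same (x (tail G d))))) (xor-identityʳ _))
    where
    x : Fin n → Bool
    x v = ⨁ vs (λ w → eqFin w v)
    go : ∀ i → walk (switchSeq G vs s) i d ≡ walk s i d xor (x (tail G d) xor x (tail G (iter φ i d)))
    go zero    = sym (xor-same (x (tail G d)))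
    go (suc i) = begin
      walk (switchSeq G vs s) i d xor switchSeq G vs s (proj₁ dᵢ)
        ≡⟨ cong₂ _xor_ (go i) (trans (switchSeq-∂ vs s (proj₁ dᵢ)) (cong (s (proj₁ dᵢ) xor_) (∂-dart (x ∘ tail G) dᵢ))) ⟩
      (walk s i d xor (x₀ xor x (tail G dᵢ))) xor (s (proj₁ dᵢ) xor (x (tail G dᵢ) xor x (tail G (rev G dᵢ))))
        ≡⟨ interchange (walk s i d) _ _ _ ⟩
      walk s (suc i) d xor ((x₀ xor x (tail G dᵢ)) xor (x (tail G dᵢ) xor x (tail G (rev G dᵢ))))
        ≡⟨ cong (walk s (suc i) d xor_) (xor-telescope x₀ _ _) ⟩
      walk s (suc i) d xor (x₀ xor x (tail G (rev G dᵢ)))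
        ≡⟨ cong (λ v → walk s (suc i) d xor (x₀ xor x v)) (ρ-tail (rev G dᵢ)) ⟨
      walk s (suc i) d xor (x₀ xor x (tail G (φ dᵢ))) ∎
      where
      open ≡-Reasoning
      dᵢ = iter φ i d
      x₀ = x (tail G d)

  walk-false : ∀ s i d → (∀ {j} → j < i → s (proj₁ (iter φ j d)) ≡ false) → walk s i d ≡ false
  walk-false s zero    d off = refl
  walk-false s (suc i) d off = cong₂ _xor_ (walk-false s i d (off ∘ ℕ.m<n⇒m<1+n)) (off (ℕ.n<1+n i))

  walk-first : ∀ s i d → s (proj₁ d) ≡ true → (∀ {j} → 0 < j → j < suc i → s (proj₁ (iter φ j d)) ≡ false) →
               walk s (suc i) d ≡ true
  walk-first s zero    d on off = on
  walk-first s (suc i) d on off =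
    cong₂ _xor_ (walk-first s i d on (λ 0<j j< → off 0<j (ℕ.m<n⇒m<1+n j<))) (off (s≤s z≤n) (ℕ.n<1+n (suc i)))

  iter-face : ∀ i d → face (iter φ i d) ≡ face d
  iter-face zero    d = refl
  iter-face (suc i) d = trans (face-φ (iter φ i d)) (iter-face i d)

  -- Facial orbits are exhausted within 2m steps.

  bit : Bool → Fin 2
  bit b = if b then suc zero else zero

  bit-injective : ∀ a b → bit a ≡ bit b → a ≡ b
  bit-injective false false _ = refl
  bit-injective true  true  _ = refl

  dartIndex : Dart G → Fin (2 * m)
  dartIndex (e , b) = F.combine (bit b) e

  dartIndex-injective : ∀ d d′ → dartIndex d ≡ dartIndex d′ → d ≡ d′
  dartIndex-injective (e , b) (e′ , b′) eq with p , q ← combine-injective (bit b) e (bit b′) e′ eq = cong₂ _,_ q (bit-injective b b′ p)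

  -- A repetition among the first 2m + 1 iterates shortens every longer index.
  orbit-short : ∀ {d d′} i → Acc _<_ i → iter φ i d ≡ d′ → ∃ λ j → j < 2 * m × iter φ j d ≡ d′
  orbit-short {d} {d′} i (acc rec) hit with i ℕ.<? 2 * m
  ... | yes i<2m = i , i<2m , hit
  ... | no i≮2m with p , q , p<q , same ← pigeonhole (ℕ.n<1+n (2 * m)) (λ k → dartIndex (iter φ (F.toℕ k) d))
    = orbit-short (i ∸ F.toℕ q + F.toℕ p) (rec shorter) (begin
        iter φ (i ∸ F.toℕ q + F.toℕ p) d            ≡⟨ iter-+ φ (i ∸ F.toℕ q) (F.toℕ p) d ⟩
        iter φ (i ∸ F.toℕ q) (iter φ (F.toℕ p) d)   ≡⟨ cong (iter φ (i ∸ F.toℕ q)) (dartIndex-injective _ _ same) ⟩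
        iter φ (i ∸ F.toℕ q) (iter φ (F.toℕ q) d)   ≡⟨ iter-+ φ (i ∸ F.toℕ q) (F.toℕ q) d ⟨
        iter φ (i ∸ F.toℕ q + F.toℕ q) d            ≡⟨ cong (λ k → iter φ k d) (ℕ.m∸n+n≡m q≤i) ⟩
        iter φ i d                                  ≡⟨ hit ⟩
        d′                                          ∎)
    where
    open ≡-Reasoning
    q≤i : F.toℕ q ≤ i
    q≤i = ℕ.≤-trans (ℕ.≤-pred (toℕ<n q)) (ℕ.≮⇒≥ i≮2m)
    shorter : i ∸ F.toℕ q + F.toℕ p < i
    shorter = subst (i ∸ F.toℕ q + F.toℕ p <_) (ℕ.m∸n+n≡m q≤i) (ℕ.+-monoʳ-< (i ∸ F.toℕ q) p<q)

  -- Face labels name the orbits of `φ`, and by `orbit-short` the bounded search misses no dart of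
  -- an orbit.
  inOrbitB-face : ∀ d d′ → inOrbitB G φ d d′ ≡ eqFin (face d) (face d′)
  inOrbitB-face d d′ = agree (inOrbitB G φ d d′) refl (face d F.≟ face d′)
    where
    test : ℕ → Bool
    test i = eqDart G (iter φ i d) d′
    agree : ∀ b → inOrbitB G φ d d′ ≡ b → (f? : Dec (face d ≡ face d′)) → b ≡ ⌊ f? ⌋
    agree true  eq (yes _) = refl
    agree false eq (no _)  = refl
    agree true  eq (no face≢)
      with i , _ , hit ← find (any⁻ test (upTo (2 * m)) (Equivalence.from T-≡ eq))
      with dart? (iter φ i d) d′
    ... | yes refl = contradiction (sym (iter-face i d)) face≢
    agree false eq (yes face≡)
      with i , hit ← proj₁ (proj₂ (proj₂ faceCount) d d′) face≡
      with j , j<2m , hit′ ← orbit-short i (<-wellFounded i) hit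
      = contradiction (trans (sym (Equivalence.to T-≡ (any⁺ test (lose (∈-upTo⁺ j<2m)
          (Equivalence.from T-≡ (⌊⌋-true (dart? (iter φ j d) d′) hit′)))))) eq) λ ()

  -- Facial cycles when exactly six faces are odd.

  module SixOdd (six : length oddFaces ≡ 6) where

    -- Both sides of `odd≤degree` sum to six over the faces, so each inequality is an equality.
    degree≤odd : ∀ vs → countB (switched vs) edges ≡ 3 → ∀ f → degree (switched vs) f ≤ 𝟙 (odd f)
    degree≤odd vs three f = ∑-tight (odd≤degree vs) (ℕ.≤-reflexive (begin
      ∑ (allFin nF) (degree (switched vs)) ≡⟨ ∑-degree (switched vs) three ⟩
      6                                    ≡⟨ six ⟨
      length oddFaces                      ≡⟨ countB-filter odd (allFin nF) ⟩
      countB odd (allFin nF)               ≡⟨ countB-∑ odd (allFin nF) ⟩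
      ∑ (allFin nF) (𝟙 ∘ odd)              ∎)) (∈-allFin f)
      where open ≡-Reasoning

    atDart : ∀ {s : Fin m → Bool} {f d} → face d ≡ f → s (proj₁ d) ≡ true → eqFin f (face d) ∧ s (proj₁ d) ≡ true
    atDart {d = d} refl sd = cong₂ _∧_ (eqFin-refl (face d)) sd

    -- Each face has a dart, and some minimum signature is negative on its edge. The degree of the
    -- face is then positive, and by `degree≤odd` the face is odd.
    all-odd : ∀ f → odd f ≡ true
    all-odd f with d , face-d ← proj₁ (proj₂ faceCount) f
              with vs , neg-d , three ← minimumThrough (proj₁ d)
              with odd f | degree≤odd vs three f
    ... | true  | _  = refl
    ... | false | le = contradiction (countB-≥1 (∈-darts d) (atDart {switched vs} {d = d} face-d neg-d)) (ℕ.<⇒≱ (s≤s le))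

    nF≡6 : nF ≡ 6
    nF≡6 = trans (sym (trans (trans (countB-cong (allFin nF) all-odd) (count (allFin nF))) (length-tabulate {n = nF} id)))
      (trans (sym (countB-filter odd (allFin nF))) six)
      where
      count : ∀ fs → countB {A = Fin nF} (λ _ → true) fs ≡ length fs
      count []       = refl
      count (_ ∷ fs) = cong suc (count fs)

    -- Two negative darts would give the face degree at least two, against `degree≤odd`.
    uniqueDart : ∀ vs → countB (switched vs) edges ≡ 3 → ∀ d d′ → face d ≡ face d′ →
                 switched vs (proj₁ d) ≡ true → switched vs (proj₁ d′) ≡ true → d ≡ d′
    uniqueDart vs three d d′ same neg-d neg-d′ with dart? d d′
    ... | yes d≡d′ = d≡d′
    ... | no d≢d′ = contradiction
      (ℕ.≤-trans (countB-≥2 (∈-darts d) (∈-darts d′) d≢d′ (atDart {switched vs} {d = d} same neg-d) (atDart {switched vs} {d = d′} refl neg-d′))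
        (ℕ.≤-trans (degree≤odd vs three (face d′)) (ℕ.≤-reflexive (cong 𝟙 (all-odd (face d′))))))
      (ℕ.<⇒≱ (s≤s (s≤s z≤n)))

    otherDart-positive : ∀ vs → countB (switched vs) edges ≡ 3 → ∀ d d′ → face d ≡ face d′ →
                         switched vs (proj₁ d) ≡ true → d ≢ d′ → switched vs (proj₁ d′) ≡ false
    otherDart-positive vs three d d′ same neg-d d≢d′ with switched vs (proj₁ d′) in eq
    ... | false = refl
    ... | true  = contradiction (uniqueDart vs three d d′ same neg-d eq) d≢d′

    -- In a minimum signature through the common edge, the face would carry two negative darts.
    edges-distinct : ∀ d d′ → face d ≡ face d′ → d ≢ d′ → proj₁ d ≢ proj₁ d′
    edges-distinct d d′ same d≢d′ e≡e′ with vs , neg-d , three ← minimumThrough (proj₁ d) =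
      d≢d′ (uniqueDart vs three d d′ same neg-d (subst (λ e → switched vs e ≡ true) e≡e′ neg-d))

    -- If the facial walk from d to d′ were closed, its sign would be invariant under switching; but it is
    -- negative for the minimum signature through d and positive for the one through d′.
    tails-distinct : ∀ d d′ → Orbit φ d d′ → d ≢ d′ → tail G d ≢ tail G d′
    -- Stopping at the first visit to `d′` ensures that neither `d` nor `d′` recurs inside the walk.
    tails-distinct d d′ (i , hit) d≢d′ tails with leastHit dart? φ i hit
    ... | zero  , hit′ , _     = d≢d′ hit′
    ... | suc k , refl , least
      with vs , neg-d , three ← minimumThrough (proj₁ d)
      with vs′ , neg-d′ , three′ ← minimumThrough (proj₁ (iter φ (suc k) d))
      = contradiction (begin
          true                          ≡⟨ walk-first (switched vs) k d neg-d only-d ⟨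
          walk (switched vs) (suc k) d  ≡⟨ walk-switch vs neg (suc k) d tails ⟩
          walk neg (suc k) d            ≡⟨ walk-switch vs′ neg (suc k) d tails ⟨
          walk (switched vs′) (suc k) d ≡⟨ walk-false (switched vs′) (suc k) d not-d′ ⟩
          false                         ∎) λ ()
      where
      open ≡-Reasoning
      -- Leaving out a return to `d` after `j` steps would reach `d′` earlier.
      no-return : ∀ {j} → 0 < j → j < suc k → d ≢ iter φ j d
      no-return {j} 0<j j<k d≡ = least (ℕ.∸-monoʳ-< 0<j (ℕ.<⇒≤ j<k)) (begin
        iter φ (suc k ∸ j) d              ≡⟨ cong (iter φ (suc k ∸ j)) d≡ ⟩
        iter φ (suc k ∸ j) (iter φ j d)   ≡⟨ iter-+ φ (suc k ∸ j) j d ⟨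
        iter φ (suc k ∸ j + j) d          ≡⟨ cong (λ l → iter φ l d) (ℕ.m∸n+n≡m (ℕ.<⇒≤ j<k)) ⟩
        iter φ (suc k) d                  ∎)
      only-d : ∀ {j} → 0 < j → j < suc k → switched vs (proj₁ (iter φ j d)) ≡ false
      only-d {j} 0<j j<k = otherDart-positive vs three d (iter φ j d) (sym (iter-face j d)) neg-d (no-return 0<j j<k)
      not-d′ : ∀ {j} → j < suc k → switched vs′ (proj₁ (iter φ j d)) ≡ false
      not-d′ {j} j<k = otherDart-positive vs′ three′ (iter φ (suc k) d) (iter φ j d)
        (trans (iter-face (suc k) d) (sym (iter-face j d))) neg-d′ (λ eq → least j<k (sym eq))

    sixNegativeFacialCycles : SixNegativeFacialCycles G P
    sixNegativeFacialCycles =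
      subst (NumClasses (Orbit φ)) nF≡6 faceCount ,
      (λ d d′ orbit d≢d′ → tails-distinct d d′ orbit d≢d′ ,
         edges-distinct d d′ (proj₂ (proj₂ (proj₂ faceCount) d d′) orbit) d≢d′) ,
      -- The darts counted here are those of the degree of `face d` under `neg`.
      λ d → odd?⇒Odd _ (trans (cong odd? (countB-cong (darts G) (λ d′ → cong (_∧ neg (proj₁ d′)) (inOrbitB-face d d′))))
        (trans (odd?-degree neg (face d)) (all-odd (face d))))

mainTheorem3 : (G : SignedGraph) (P : PlaneEmbedding G) →
    CriticallyFrustrated G 3 → ¬ Decomposable G 3 →
    SixNegativeFacialCycles G P
mainTheorem3 G P crit ¬dec = SixOdd.sixNegativeFacialCycles (sixOdd ¬dec)
  where open Critical G P crit
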